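{- Let $\mathrm{st}:\mathfrak{S}\to\mathbb{N}$ be a permutation statistic with $\mathrm{st}(\epsilon)=0$ for which there is a function $f:\mathbb{N}^2\to\mathbb{N}$ such that for all integers $0\le k\le n$ and all $\sigma_1\in\mathfrak{S}_k(312)$, $\sigma_2\in\mathfrak{S}_{n-k}(312)$, the permutation $\sigma=213[\sigma_1,1,\sigma_2]$ satisfies $$\mathrm{st}(\sigma)=f(k,n-k)+\mathrm{st}(\sigma_1)+\mathrm{st}(\sigma_2).$$ Let $\pi$ be a $312$-avoiding permutation with block decomposition $\pi=\iota_r[\pi_{1*},\dots,\pi_{r*}]$, and let $\Pi=\{312,\pi\}$. Then for all $n\ge 0$ $$F^{\mathrm{st}}_{n+1}(\Pi;q)=\sum_{k=0}^n q^{f(k,n-k)}\Bigg[\sum_{i=1}^r F^{\mathrm{st}}_k(\{312,\underline{\pi}(i)\};q)\,F^{\mathrm{st}}_{n-k}(\{312,\overline{\pi}(i)\};q)-\sum_{i=1}^{r-1}F^{\mathrm{st}}_k(\{312,\underline{\pi}(i)\};q)\,F^{\mathrm{st}}_{n-k}(\{312,\overline{\pi}(i+1)\};q)\Bigg],$$ where $F^{\mathrm{st}}_0(\Pi;q)=0$ if $\pi=\epsilon$, and $F^{\mathrm{st}}_0(\Pi;q)=1$ otherwise.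
   Context: $\mathbb{N}$ is the set of nonnegative integers. $\mathfrak{S}_n$ is the set of permutations of $\{1,\dots,n\}$ in one-line notation, $\mathfrak{S}=\bigcup_{n\ge 0}\mathfrak{S}_n$, and $\mathfrak{S}_0=\{\epsilon\}$ with $\epsilon$ the empty permutation. A permutation $\sigma$ contains $\pi$ if some subsequence of $\sigma$ has the same relative order as $\pi$ (so every permutation contains $\epsilon$); otherwise $\sigma$ avoids $\pi$. For $\Pi\subseteq\mathfrak{S}$, $\mathfrak{S}_n(\Pi)$ is the set of $\sigma\in\mathfrak{S}_n$ avoiding every pattern in $\Pi$; $\mathfrak{S}_n(312)=\mathfrak{S}_n(\{312\})$. For a statistic $\mathrm{st}:\mathfrak{S}\to\mathbb{N}$, $F^{\mathrm{st}}_n(\Pi;q)=\sum_{\sigma\in\mathfrak{S}_n(\Pi)}q^{\mathrm{st}(\sigma)}$. For $\tau\in\mathfrak{S}_k$ and $\sigma_1,\dots,\sigma_k\in\mathfrak{S}$, the inflation $\tau[\sigma_1,\dots,\sigma_k]$ is the permutation that is a concatenation of $k$ consecutive blocks of positions, the $i$-th block (of length $|\sigma_i|$) having the relative order of $\sigma_i$ and occupying an interval of values, with the blocks' value intervals arranged relative to one another in the order of $\tau$; e.g. $213[123,1,21]=234165$. $\iota_r=12\cdots r$ is the identity of $\mathfrak{S}_r$ (and $\iota_0[\,]=\epsilon$). For $\pi\in\mathfrak{S}_m$, $\pi_*:=21[\pi,1]$, i.e. $\pi_*=(\pi(1)+1)\cdots(\pi(m)+1)\,1$; and $\pi_{i*}=(\pi_i)_*$.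 Every $312$-avoiding permutation $\pi$ can be written uniquely as $\pi=\iota_r[\pi_{1*},\dots,\pi_{r*}]$ with $r\ge 0$ and each $\pi_i$ a $312$-avoiding permutation; this is its block decomposition. For $1\le i\le r$ define $\underline{\pi}(1)=\pi_1$, $\underline{\pi}(i)=\iota_i[\pi_{1*},\dots,\pi_{i*}]$ for $i\ge 2$, and $\overline{\pi}(i)=\iota_{r-i+1}[\pi_{i*},\dots,\pi_{r*}]$ for $1\le i\le r$. -}

module Defs where

open import Data.Empty using (⊥-elim)
open import Data.Fin using (cast)
import Data.Fin.Properties as Fin
open import Data.Integer using (ℤ; 0ℤ; 1ℤ)
import Data.Integer as ℤ
open import Data.List
  using (List; []; _∷_; [_]; _++_; applyUpTo; cartesianProductWith; concat; filter;
         foldr; length; lookup; map; mapMaybe; replicate; take; drop; zip)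
open import Data.List.Properties using (length-++; length-map; length-applyUpTo; filter-accept; filter-reject)
open import Data.List.Membership.Propositional using (_∈_)
open import Data.List.Membership.Propositional.Properties
  using (∈-∃++; ∈-map⁻; ∈-applyUpTo⁺; ∈-applyUpTo⁻)
open import Data.List.Relation.Binary.Disjoint.Propositional using (Disjoint)
open import Data.List.Relation.Binary.Permutation.Propositional
  using (_↭_; refl; prep; ↭-sym; ↭-trans; ↭⇒↭ₛ)
open import Data.List.Relation.Binary.Permutation.Propositional.Properties
  using (∈-resp-↭; ↭-length; shift)
import Data.List.Relation.Binary.Permutation.Setoid.Properties as Permₛ
open import Data.List.Relation.Binary.Sublist.Propositional using (_⊆_; []; _∷_; _∷ʳ_)
open import Data.List.Relation.Unary.All using (All; []; _∷_; all?; tabulate)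
import Data.List.Relation.Unary.All as All
import Data.List.Relation.Unary.All.Properties as Allₚ
open import Data.List.Relation.Unary.AllPairs using (AllPairs; []; _∷_)
import Data.List.Relation.Unary.AllPairs.Properties as AllPairsₚ
open import Data.List.Relation.Unary.Any using (here; there)
open import Data.List.Relation.Unary.Unique.Propositional using (Unique)
import Data.List.Relation.Unary.Unique.Propositional.Properties as Uniqueₚ
open import Data.Maybe using (Maybe)
import Data.Maybe as Maybe
open import Data.Nat
open import Data.Nat.ListAction using (sum)
open import Data.Nat.Properties
open import Data.Product using (Σ; _×_; _,_; proj₁; proj₂; ∃-syntax; _,′_)
open import Function using (_∘_; _⇔_; mk⇔; Equivalence; case_of_)
open import Relation.Binary.Definitions using (tri<; tri≈; tri>)
open import Relation.Binary.PropositionalEquality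
  using (_≡_; _≢_; refl; sym; trans; cong; cong₂; subst; setoid)
open import Relation.Nullary using (¬_; Dec; yes; no; ¬?; recompute)
open import Relation.Nullary.Decidable
  using (True; toWitness; map′; _×-dec_; _→-dec_; _⊎-dec_; dec⇒maybe)
open import Relation.Unary using (Decidable)
open import Data.Sum using (_⊎_; inj₁; inj₂)

------------------------------------------------------------------------
-- Polynomials in one indeterminate q over ℤ

-- Coefficient lists, constant term first.  Trailing zeros are allowed, so
-- equality of polynomials is _≈_, not _≡_.
Poly : Set
Poly = List ℤ

coeff : Poly → ℕ → ℤ
coeff []      _       = 0ℤ
coeff (a ∷ p) zero    = a
coeff (a ∷ p) (suc i) = coeff p i

infix 4 _≈_
_≈_ : Poly → Poly → Set
p ≈ p′ = ∀ i → coeff p i ≡ coeff p′ i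

0ₚ 1ₚ : Poly
0ₚ = []
1ₚ = [ 1ℤ ]

infixl 6 _+ₚ_ _-ₚ_
infixl 7 _*ₚ_
infix  8 q^_

_+ₚ_ : Poly → Poly → Poly
[]      +ₚ p′       = p′
(a ∷ p) +ₚ []       = a ∷ p
(a ∷ p) +ₚ (b ∷ p′) = (a ℤ.+ b) ∷ (p +ₚ p′)

_-ₚ_ : Poly → Poly → Poly
p -ₚ p′ = p +ₚ map ℤ.-_ p′

_*ₚ_ : Poly → Poly → Poly
[]      *ₚ p′ = []
(a ∷ p) *ₚ p′ = map (a ℤ.*_) p′ +ₚ (0ℤ ∷ p *ₚ p′)

q^_ : ℕ → Poly
q^ n = replicate n 0ℤ ++ 1ₚ

∑ : ∀ {A : Set} → List A → (A → Poly) → Poly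
∑ xs g = foldr _+ₚ_ 0ₚ (map g xs)

infix 5 ∑
syntax ∑ xs (λ x → e) = ∑[ x ∈ xs ] e

-- a, a + 1, …, b; empty when b < a.
[_⋯_] : ℕ → ℕ → List ℕ
[ a ⋯ b ] = applyUpTo (a +_) (suc b ∸ a)

------------------------------------------------------------------------
-- Permutations in one-line notation

IsPermutation : List ℕ → Set
IsPermutation w = w ↭ [ 1 ⋯ length w ]

module _ where
  private
    ∈-remove : ∀ {x y : ℕ} as bs → y ∈ as ++ x ∷ bs → x ≢ y → y ∈ as ++ bs
    ∈-remove []       bs (here refl) x≢y = ⊥-elim (x≢y refl)
    ∈-remove []       bs (there m)   x≢y = m
    ∈-remove (a ∷ as) bs (here eq)   x≢y = here eq
    ∈-remove (a ∷ as) bs (there m)   x≢y = there (∈-remove as bs m x≢y)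

    pigeonhole : ∀ {xs ys : List ℕ} → Unique xs → (∀ {x} → x ∈ xs → x ∈ ys) →
                 length xs ≡ length ys → xs ↭ ys
    pigeonhole {[]}     {[]} _ _ _ = refl
    pigeonhole {x ∷ xs} (x∉xs ∷ uxs) sub len with ∈-∃++ (sub (here refl))
    ... | as , bs , refl =
      ↭-trans
        (prep x (pigeonhole uxs
          (λ y∈xs → ∈-remove as bs (sub (there y∈xs)) (All.lookup x∉xs y∈xs))
          (suc-injective (trans len (↭-length (shift x as bs))))))
        (↭-sym (shift x as bs))

  distinct-bounded⇒perm : ∀ {w} → Unique w → All (λ x → 1 ≤ x × x ≤ length w) w →
                          IsPermutation w
  distinct-bounded⇒perm {w} uw bw = pigeonhole uw sub (sym (length-applyUpTo suc (length w)))
    where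
    sub : ∀ {x} → x ∈ w → x ∈ [ 1 ⋯ length w ]
    sub {x} x∈w with x | All.lookup bw x∈w
    ... | suc y | _ , y<n = ∈-applyUpTo⁺ suc y<n

  perm⇒distinct : ∀ {w} → IsPermutation w → Unique w
  perm⇒distinct {w} p = Permₛ.Unique-resp-↭ (setoid ℕ) (↭⇒↭ₛ (↭-sym p))
    (Uniqueₚ.applyUpTo⁺₁ suc (length w) (λ i<j _ eq → <⇒≢ i<j (suc-injective eq)))

  perm⇒bounded : ∀ {w} → IsPermutation w → All (λ x → 1 ≤ x × x ≤ length w) w
  perm⇒bounded {w} p = tabulate λ x∈w →
    case ∈-applyUpTo⁻ suc (∈-resp-↭ p x∈w) of λ { (i , i<n , refl) → s≤s z≤n , i<n }

isPermutation? : Decidable IsPermutation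
isPermutation? w =
  map′ (λ { (u , b) → distinct-bounded⇒perm u b })
       (λ p → perm⇒distinct p , perm⇒bounded p)
       (unique? w ×-dec all? (λ x → (1 ≤? x) ×-dec (x ≤? length w)) w)
  where open import Data.List.Relation.Unary.Unique.DecPropositional _≟_ using (unique?)

-- The proof field is irrelevant: permutations with the same word are equal.
record 𝔖 : Set where
  constructor perm
  field
    word    : List ℕ
    .isPerm : IsPermutation word

open 𝔖 public using (word)

isPermutation : (σ : 𝔖) → IsPermutation (word σ)
isPermutation (perm w p) = recompute (isPermutation? w) p

∣_∣ : 𝔖 → ℕ
∣ σ ∣ = length (word σ)

⟦_⟧ : (w : List ℕ) {_ : True (isPermutation? w)} → 𝔖
⟦ w ⟧ {p} = perm w (toWitness p)

ε p1 p21 p213 p312 : 𝔖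
ε    = ⟦ [] ⟧
p1   = ⟦ 1 ∷ [] ⟧
p21  = ⟦ 2 ∷ 1 ∷ [] ⟧
p213 = ⟦ 2 ∷ 1 ∷ 3 ∷ [] ⟧
p312 = ⟦ 3 ∷ 1 ∷ 2 ∷ [] ⟧

∣[1⋯_]∣ : ∀ r → length [ 1 ⋯ r ] ≡ r
∣[1⋯ r ]∣ = length-applyUpTo suc r

ι : ℕ → 𝔖
ι r = perm [ 1 ⋯ r ] (subst (λ m → [ 1 ⋯ r ] ↭ [ 1 ⋯ m ]) (sym ∣[1⋯ r ]∣) refl)

------------------------------------------------------------------------
-- Pattern containment

-- u and v have the same relative order.
infix 4 _≅_
_≅_ : List ℕ → List ℕ → Set
u ≅ v = Σ (length u ≡ length v) λ eq →
  ∀ i j → lookup u i < lookup u j ⇔ lookup v (cast eq i) < lookup v (cast eq j)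

infix 4 _Contains_ _Avoids_
_Contains_ : 𝔖 → 𝔖 → Set
σ Contains π = ∃[ w ] w ⊆ word σ × w ≅ word π

_Avoids_ : 𝔖 → 𝔖 → Set
σ Avoids π = ¬ σ Contains π

_∈𝔖_⟨_⟩ : 𝔖 → ℕ → List 𝔖 → Set
σ ∈𝔖 n ⟨ Π ⟩ = ∣ σ ∣ ≡ n × All (σ Avoids_) Π

_≅?_ : ∀ u v → Dec (u ≅ v)
u ≅? v with length u ≟ length v
... | no ≢ = no (≢ ∘ proj₁)
... | yes eq = map′ (eq ,_) (λ { (_ , h) → h })
  (Fin.all? λ i → Fin.all? λ j → ⇔-dec (_ <? _) (_ <? _))
  where
  ⇔-dec : ∀ {A B : Set} → Dec A → Dec B → Dec (A ⇔ B)
  ⇔-dec a? b? = map′ (λ { (f , g) → mk⇔ f g }) (λ e → Equivalence.to e , Equivalence.from e)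
    ((a? →-dec b?) ×-dec (b? →-dec a?))

anySublist? : ∀ {P : List ℕ → Set} → Decidable P → ∀ xs → Dec (∃[ w ] w ⊆ xs × P w)
anySublist? P? [] = map′ (λ p → [] , [] , p) (λ { (_ , [] , p) → p }) (P? [])
anySublist? {P} P? (x ∷ xs) = map′ to from
  (anySublist? P? xs ⊎-dec anySublist? (P? ∘ (x ∷_)) xs)
  where
  to : (∃[ w ] w ⊆ xs × P w) ⊎ (∃[ w ] w ⊆ xs × P (x ∷ w)) → ∃[ w ] w ⊆ x ∷ xs × P w
  to (inj₁ (w , s , p)) = w , x ∷ʳ s , p
  to (inj₂ (w , s , p)) = x ∷ w , refl ∷ s , p
  from : ∃[ w ] w ⊆ x ∷ xs × P w → (∃[ w ] w ⊆ xs × P w) ⊎ (∃[ w ] w ⊆ xs × P (x ∷ w))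
  from (w , _ ∷ʳ s , p)          = inj₁ (w , s , p)
  from (_ ∷ w , refl ∷ s , p)    = inj₂ (w , s , p)

_Avoids?_ : ∀ σ π → Dec (σ Avoids π)
σ Avoids? π = ¬? (anySublist? (_≅? word π) (word σ))

------------------------------------------------------------------------
-- Generating polynomials

wordsOver : List ℕ → ℕ → List (List ℕ)
wordsOver A zero    = [ [] ]
wordsOver A (suc m) = cartesianProductWith _∷_ A (wordsOver A m)

toPerm : List ℕ → Maybe 𝔖
toPerm w = Maybe.map (λ p → perm w p) (dec⇒maybe (isPermutation? w))

-- All permutations of size n, each listed once: the words of length n over
-- {1, …, n} that are permutations.
permutations : ℕ → List 𝔖
permutations n = mapMaybe toPerm (wordsOver [ 1 ⋯ n ] n)

𝔖[_]⟨_⟩ : ℕ → List 𝔖 → List 𝔖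
𝔖[ n ]⟨ Π ⟩ = filter (λ σ → all? (σ Avoids?_) Π) (permutations n)

F : (𝔖 → ℕ) → ℕ → List 𝔖 → Poly
F st n Π = ∑[ σ ∈ 𝔖[ n ]⟨ Π ⟩ ] q^ st σ

------------------------------------------------------------------------
-- Inflation

-- In τ[σ₁,…,σₖ] the block of σᵢ is shifted up by the total size of the blocks
-- lying below it, i.e. of those σⱼ with τ(j) < τ(i).  The argument ps lists
-- the pairs (τ(j) , σⱼ).
offset : List (ℕ × 𝔖) → ℕ → ℕ
offset ps t = sum (map (∣_∣ ∘ proj₂) (filter (λ p → proj₁ p <? t) ps))

block : List (ℕ × 𝔖) → ℕ × 𝔖 → List ℕ
block ps (t , σ) = map (offset ps t +_) (word σ)

inflateWord : List (ℕ × 𝔖) → List ℕ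
inflateWord ps = concat (map (block ps) ps)

module _ where
  private
    size : ℕ × 𝔖 → ℕ
    size = ∣_∣ ∘ proj₂

    total : List (ℕ × 𝔖) → ℕ
    total ps = sum (map size ps)

    length-blocks : ∀ ps qs → length (concat (map (block ps) qs)) ≡ total qs
    length-blocks ps []             = refl
    length-blocks ps ((t , σ) ∷ qs) =
      trans (length-++ (block ps (t , σ)))
            (cong₂ _+_ (length-map _ (word σ)) (length-blocks ps qs))

    offset-yes : ∀ p ps {t} → proj₁ p < t → offset (p ∷ ps) t ≡ size p + offset ps t
    offset-yes p ps {t} p<t = cong (sum ∘ map size) (filter-accept (λ r → proj₁ r <? t) p<t)

    offset-no : ∀ p ps {t} → ¬ proj₁ p < t → offset (p ∷ ps) t ≡ offset ps t
    offset-no p ps {t} p≮t = cong (sum ∘ map size) (filter-reject (λ r → proj₁ r <? t) p≮t)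

    offset-mono : ∀ {t s} ps → t ≤ s → offset ps t ≤ offset ps s
    offset-mono []       t≤s = z≤n
    offset-mono {t} {s} (p ∷ ps) t≤s = case ((proj₁ p <? t) ,′ (proj₁ p <? s)) of λ where
      (yes p<t , yes p<s) → ≤-trans (≤-reflexive (offset-yes p ps p<t))
        (≤-trans (+-monoʳ-≤ (size p) (offset-mono ps t≤s)) (≤-reflexive (sym (offset-yes p ps p<s))))
      (yes p<t , no p≮s)  → ⊥-elim (p≮s (<-≤-trans p<t t≤s))
      (no p≮t , yes p<s)  → ≤-trans (≤-reflexive (offset-no p ps p≮t))
        (≤-trans (m≤n⇒m≤o+n (size p) (offset-mono ps t≤s)) (≤-reflexive (sym (offset-yes p ps p<s))))
      (no p≮t , no p≮s)   → ≤-trans (≤-reflexive (offset-no p ps p≮t))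
        (≤-trans (offset-mono ps t≤s) (≤-reflexive (sym (offset-no p ps p≮s))))

    offset-step : ∀ {p s} ps → p ∈ ps → proj₁ p < s → offset ps (proj₁ p) + size p ≤ offset ps s
    offset-step {p} {s} (p ∷ ps) (here refl) t<s =
      ≤-trans (≤-reflexive (trans (cong (_+ size p) (offset-no p ps (<-irrefl refl))) (+-comm _ (size p))))
        (≤-trans (+-monoʳ-≤ (size p) (offset-mono ps (<⇒≤ t<s)))
          (≤-reflexive (sym (offset-yes p ps t<s))))
    offset-step {p} {s} (r ∷ ps) (there p∈ps) t<s = case ((proj₁ r <? proj₁ p) ,′ (proj₁ r <? s)) of λ where
      (yes r<t , yes r<s) →
        ≤-trans (≤-reflexive (trans (cong (_+ size p) (offset-yes r ps r<t)) (+-assoc (size r) _ (size p))))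
          (≤-trans (+-monoʳ-≤ (size r) (offset-step ps p∈ps t<s))
            (≤-reflexive (sym (offset-yes r ps r<s))))
      (yes r<t , no r≮s)  → ⊥-elim (r≮s (<-trans r<t t<s))
      (no r≮t , yes r<s)  → ≤-trans (≤-reflexive (cong (_+ size p) (offset-no r ps r≮t)))
        (≤-trans (m≤n⇒m≤o+n (size r) (offset-step ps p∈ps t<s)) (≤-reflexive (sym (offset-yes r ps r<s))))
      (no r≮t , no r≮s)   → ≤-trans (≤-reflexive (cong (_+ size p) (offset-no r ps r≮t)))
        (≤-trans (offset-step ps p∈ps t<s) (≤-reflexive (sym (offset-no r ps r≮s))))

    offset≤total : ∀ t ps → offset ps t ≤ total ps
    offset≤total t []       = z≤n
    offset≤total t (p ∷ ps) = case proj₁ p <? t of λ where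
      (yes p<t) → ≤-trans (≤-reflexive (offset-yes p ps p<t)) (+-monoʳ-≤ (size p) (offset≤total t ps))
      (no p≮t)  → ≤-trans (≤-reflexive (offset-no p ps p≮t)) (m≤n⇒m≤o+n (size p) (offset≤total t ps))

    offset-bound : ∀ {p} ps → p ∈ ps → offset ps (proj₁ p) + size p ≤ total ps
    offset-bound {p} ps p∈ps = ≤-trans (offset-step ps p∈ps ≤-refl) (offset≤total (suc (proj₁ p)) ps)

    block-bounded : ∀ ps p {x} → x ∈ block ps p →
                    offset ps (proj₁ p) < x × x ≤ offset ps (proj₁ p) + size p
    block-bounded ps (t , σ) x∈ with ∈-map⁻ (offset ps t +_) x∈
    ... | y , y∈σ , refl with All.lookup (perm⇒bounded (isPermutation σ)) y∈σ
    ... | 1≤y , y≤n =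
      ≤-trans (≤-reflexive (+-comm 1 (offset ps t))) (+-monoʳ-≤ (offset ps t) 1≤y)
      , +-monoʳ-≤ (offset ps t) y≤n

    blocks-disjoint : ∀ ps {p p′} → p ∈ ps → p′ ∈ ps → proj₁ p ≢ proj₁ p′ →
                      Disjoint (block ps p) (block ps p′)
    blocks-disjoint ps {p} {p′} p∈ p′∈ t≢t′ (x∈ , x∈′)
      with block-bounded ps p x∈ | block-bounded ps p′ x∈′ | <-cmp (proj₁ p) (proj₁ p′)
    ... | _ , hi | lo , _ | tri< t<t′ _ _ =
      <-irrefl refl (<-≤-trans lo (≤-trans hi (offset-step ps p∈ t<t′)))
    ... | _      | _      | tri≈ _ t≡t′ _ = t≢t′ t≡t′
    ... | lo , _ | _ , hi | tri> _ _ t′<t =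
      <-irrefl refl (<-≤-trans lo (≤-trans hi (offset-step ps p′∈ t′<t)))

    AllPairs-map∈ : ∀ {A : Set} {R S : A → A → Set} {xs : List A} →
                    (∀ {x y} → x ∈ xs → y ∈ xs → R x y → S x y) → AllPairs R xs → AllPairs S xs
    AllPairs-map∈ h []         = []
    AllPairs-map∈ h (rx ∷ rxs) =
      tabulate (λ y∈ → h (here refl) (there y∈) (All.lookup rx y∈))
      ∷ AllPairs-map∈ (λ x∈ y∈ → h (there x∈) (there y∈)) rxs

    map-proj₁-zip : ∀ (ts : List ℕ) (σs : List 𝔖) → length σs ≡ length ts →
                    map proj₁ (zip ts σs) ≡ ts
    map-proj₁-zip []       []       _  = refl
    map-proj₁-zip (t ∷ ts) (σ ∷ σs) eq = cong (t ∷_) (map-proj₁-zip ts σs (suc-injective eq))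

    inflateWord-perm : ∀ ps → Unique (map proj₁ ps) → IsPermutation (inflateWord ps)
    inflateWord-perm ps u = distinct-bounded⇒perm
      (Uniqueₚ.concat⁺
        (Allₚ.map⁺ (tabulate λ {p} _ →
          Uniqueₚ.map⁺ (+-cancelˡ-≡ _ _ _) (perm⇒distinct (isPermutation (proj₂ p)))))
        (AllPairsₚ.map⁺ (AllPairs-map∈ (λ p∈ p′∈ → blocks-disjoint ps p∈ p′∈) (AllPairsₚ.map⁻ u))))
      (Allₚ.concat⁺ (Allₚ.map⁺ (tabulate λ {p} p∈ → tabulate λ x∈ →
        case block-bounded ps p x∈ of λ { (lo , hi) →
          ≤-trans (s≤s z≤n) lo ,
          ≤-trans hi (≤-trans (offset-bound ps p∈) (≤-reflexive (sym (length-blocks ps ps)))) })))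

  inflate-perm : ∀ τ σs → length σs ≡ ∣ τ ∣ → IsPermutation (inflateWord (zip (word τ) σs))
  inflate-perm τ σs eq = inflateWord-perm (zip (word τ) σs)
    (subst Unique (sym (map-proj₁-zip (word τ) σs eq)) (perm⇒distinct (isPermutation τ)))

inflate : (τ : 𝔖) (σs : List 𝔖) → .(length σs ≡ ∣ τ ∣) → 𝔖
inflate τ σs eq = perm (inflateWord (zip (word τ) σs)) (inflate-perm τ σs eq)

213[_,1,_] : 𝔖 → 𝔖 → 𝔖
213[ σ₁ ,1, σ₂ ] = inflate p213 (σ₁ ∷ p1 ∷ σ₂ ∷ []) refl

-- ι_r[σ₁,…,σᵣ], where r is the length of the list.
ι[_] : List 𝔖 → 𝔖
ι[ σs ] = inflate (ι (length σs)) σs (sym ∣[1⋯ length σs ]∣)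

infix 9 _⋆
_⋆ : 𝔖 → 𝔖
π ⋆ = inflate p21 (π ∷ p1 ∷ []) refl

------------------------------------------------------------------------
-- Block decompositions of 312-avoiding permutations

IsBlockDecomposition : List 𝔖 → 𝔖 → Set
IsBlockDecomposition πs π = All (_Avoids p312) πs × π ≡ ι[ map _⋆ πs ]

-- The permutations written π with an underline, resp. overline, and (i), for the block decomposition
-- πs = π₁, …, πᵣ of π and 1 ≤ i ≤ r.
lower : List 𝔖 → ℕ → 𝔖
lower (π₁ ∷ _) 1 = π₁
lower πs       i = ι[ map _⋆ (take i πs) ]

upper : List 𝔖 → ℕ → 𝔖
upper πs i = ι[ map _⋆ (drop (i ∸ 1) πs) ]

module Submission where

-- Deleting the letter 1 writes each 312-avoider of size n + 1 uniquely as
-- σ = 213[σ₁,1,σ₂], that is σ = σ₁⋆ ⊕ σ₂.  The blocks πᵢ⋆ of π end with their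
-- minimum, so an occurrence of π in σ never cuts a block: σ contains π iff for
-- some i the first i blocks occur in σ₁⋆ and the others in σ₂.  For i ≥ 2 the
-- final 1 of σ₁⋆ cannot be used, and for i = 1 it can be cancelled against that
-- of π₁⋆, so the first condition says that σ₁ contains lower i.  Both conditions
-- are monotone in i, hence the alternating sum of products of avoidance
-- indicators telescopes to the indicator of the avoidance of π; summing it
-- against q^st over all pairs (σ₁, σ₂) gives the recurrence.

open import Defs
open import Data.Bool using (Bool; true; false; _∧_; _∨_; if_then_else_)
open import Data.Bool.Properties using (∧-comm; ∧-zeroʳ; ∧-identityʳ; ∨-zeroʳ; ¬-not)
open import Data.Empty using (⊥-elim)
open import Data.Fin using (cast; zero; suc)
open import Data.Integer using (ℤ; 0ℤ; 1ℤ) renaming (_+_ to _+ᶻ_; _*_ to _*ᶻ_; _-_ to _-ᶻ_)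
import Data.Integer as ℤ
import Data.Integer.Properties as ℤ
open import Data.Integer.Tactic.RingSolver using (solve-∀)
open import Data.List
  using (List; []; _∷_; _++_; applyUpTo; cartesianProductWith; concat; drop; filter;
         length; lookup; map; mapMaybe; take; zip)
open import Data.List.Membership.Propositional using (_∈_; _∉_)
open import Data.List.Membership.Propositional.Properties
  using (∈-++⁺ˡ; ∈-++⁺ʳ; ∈-++⁻; ∈-∃++; ∈-applyUpTo⁺; ∈-applyUpTo⁻; ∈-cartesianProductWith⁺;
         ∈-cartesianProductWith⁻; ∈-concat⁺′; ∈-concat⁻′; ∈-filter⁺; ∈-filter⁻; ∈-map⁺; ∈-map⁻)
open import Data.List.Membership.Propositional.Properties.WithK using (unique∧set⇒bag)
open import Data.List.Properties
  using (++-assoc; ++-conicalʳ; ++-identityʳ; applyUpTo-∷ʳ; drop-all; filter-accept; filter-none;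
         length-++; length-applyUpTo; length-map; map-++; map-cong; map-id; map-injective; map-∘;
         ∷-injective; ∷-injectiveʳ; ∷-injectiveˡ; ∷ʳ-injectiveˡ)
open import Data.List.Relation.Binary.BagAndSetEquality using (∼bag⇒↭)
open import Data.List.Relation.Binary.Disjoint.Propositional using (Disjoint)
open import Data.List.Relation.Binary.Permutation.Propositional using (_↭_; ↭-sym)
import Data.List.Relation.Binary.Permutation.Propositional as ↭
open import Data.List.Relation.Binary.Permutation.Propositional.Properties using (∈-resp-↭)
open import Data.List.Relation.Binary.Sublist.Propositional
  using (_⊆_; []; _∷_; _∷ʳ_; from∈; minimum; ⊆-refl; ⊆-trans)
import Data.List.Relation.Binary.Sublist.Propositional as Sublist
import Data.List.Relation.Binary.Sublist.Propositional.Properties as Sublistₚ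
open import Data.List.Relation.Unary.All using (All; []; _∷_)
import Data.List.Relation.Unary.All as All
import Data.List.Relation.Unary.All.Properties as Allₚ
open import Data.List.Relation.Unary.AllPairs using (AllPairs; []; _∷_)
import Data.List.Relation.Unary.AllPairs.Properties as AllPairsₚ
open import Data.List.Relation.Unary.Any using (here; there)
open import Data.List.Relation.Unary.Unique.Propositional using (Unique)
import Data.List.Relation.Unary.Unique.Propositional.Properties as Uniqueₚ
import Data.Maybe as Maybe
open import Data.Nat
open import Data.Nat.ListAction using (sum)
open import Data.Nat.Properties
open import Data.Product using (_×_; _,_; _,′_; proj₁; proj₂; map₁; map₂; ∃-syntax; ∃₂)
open import Data.Sum using (_⊎_; inj₁; inj₂; [_,_]′)
open import Function using (_∘_; _⇔_; mk⇔; Equivalence; case_of_)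
open import Function.Construct.Composition using (_⇔-∘_)
open import Relation.Binary.Definitions using (tri<; tri≈; tri>)
open import Relation.Binary.PropositionalEquality
  using (_≡_; _≢_; refl; sym; trans; cong; cong₂; subst; subst₂; ≢-sym; module ≡-Reasoning)
open import Relation.Nullary using (¬_; does; yes; no; _because_)
open import Relation.Nullary.Decidable using (dec-true; dec-false; dec⇒maybe; decidable-stable)
open import Relation.Unary using (Decidable)

-- Finite integer sums

-- Two obstacles shape the proof. Polynomials agree only up to trailing zeros, so `_≈_` does not
-- rewrite inside expressions, and a coefficient of a product is not a product of coefficients. Both
-- disappear under an arbitrary additive functional φ from polynomials to integers that respects
-- `_≈_`: it turns sums of polynomials into integer sums, and the map taking p to φ (r *ₚ p) is
-- again such a functional, so the factors of a product can be expanded one after the other. Each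
-- side becomes an integer sum over pairs of 312-avoiders, with an integer weight times φ of a
-- monomial, and only the weights are left to compare.
--
-- The second obstacle is that the pieces of an occurrence are shifted words, not permutations.
-- Containment is therefore moved to bare words, where it is a preorder that does not see shifts;
-- the containments that follow are mostly chains in this preorder.

Σℤ : ∀ {A : Set} → List A → (A → ℤ) → ℤ
Σℤ []       g = 0ℤ
Σℤ (x ∷ xs) g = g x +ᶻ Σℤ xs g

Σℤ-cong : ∀ {A : Set} (xs : List A) {g h} → (∀ {x} → x ∈ xs → g x ≡ h x) → Σℤ xs g ≡ Σℤ xs h
Σℤ-cong []       eq = refl
Σℤ-cong (x ∷ xs) eq = cong₂ _+ᶻ_ (eq (here refl)) (Σℤ-cong xs (eq ∘ there))

Σℤ-++ : ∀ {A : Set} (xs ys : List A) g → Σℤ (xs ++ ys) g ≡ Σℤ xs g +ᶻ Σℤ ys g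
Σℤ-++ []       ys g = sym (ℤ.+-identityˡ _)
Σℤ-++ (x ∷ xs) ys g = trans (cong (g x +ᶻ_) (Σℤ-++ xs ys g)) (sym (ℤ.+-assoc (g x) _ _))

Σℤ-map : ∀ {A B : Set} (f : A → B) xs g → Σℤ (map f xs) g ≡ Σℤ xs (g ∘ f)
Σℤ-map f []       g = refl
Σℤ-map f (x ∷ xs) g = cong (g (f x) +ᶻ_) (Σℤ-map f xs g)

Σℤ-concat : ∀ {A : Set} (xss : List (List A)) g → Σℤ (concat xss) g ≡ Σℤ xss (λ xs → Σℤ xs g)
Σℤ-concat []         g = refl
Σℤ-concat (xs ∷ xss) g = trans (Σℤ-++ xs (concat xss) g) (cong (Σℤ xs g +ᶻ_) (Σℤ-concat xss g))

Σℤ-cartesianProductWith : ∀ {A B C : Set} (f : A → B → C) xs ys g →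
  Σℤ (cartesianProductWith f xs ys) g ≡ Σℤ xs (λ x → Σℤ ys (λ y → g (f x y)))
Σℤ-cartesianProductWith f []       ys g = refl
Σℤ-cartesianProductWith f (x ∷ xs) ys g = trans (Σℤ-++ (map (f x) ys) _ g)
  (cong₂ _+ᶻ_ (Σℤ-map (f x) ys g) (Σℤ-cartesianProductWith f xs ys g))

Σℤ-↭ : ∀ {A : Set} {xs ys : List A} g → xs ↭ ys → Σℤ xs g ≡ Σℤ ys g
Σℤ-↭ g ↭.refl         = refl
Σℤ-↭ g (↭.prep x p)   = cong (g x +ᶻ_) (Σℤ-↭ g p)
Σℤ-↭ g (↭.swap x y p) rewrite Σℤ-↭ g p = lemma (g x) (g y) _
  where
  lemma : ∀ a b c → a +ᶻ (b +ᶻ c) ≡ b +ᶻ (a +ᶻ c)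
  lemma = solve-∀
Σℤ-↭ g (↭.trans p q)  = trans (Σℤ-↭ g p) (Σℤ-↭ g q)

Σℤ-zero : ∀ {A : Set} (xs : List A) → Σℤ xs (λ _ → 0ℤ) ≡ 0ℤ
Σℤ-zero []       = refl
Σℤ-zero (x ∷ xs) = trans (ℤ.+-identityˡ _) (Σℤ-zero xs)

Σℤ-+ : ∀ {A : Set} (xs : List A) g h → Σℤ xs (λ x → g x +ᶻ h x) ≡ Σℤ xs g +ᶻ Σℤ xs h
Σℤ-+ []       g h = refl
Σℤ-+ (x ∷ xs) g h rewrite Σℤ-+ xs g h = lemma (g x) (h x) _ _
  where
  lemma : ∀ a b c d → a +ᶻ b +ᶻ (c +ᶻ d) ≡ a +ᶻ c +ᶻ (b +ᶻ d)
  lemma = solve-∀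

Σℤ-- : ∀ {A : Set} (xs : List A) g h → Σℤ xs (λ x → g x -ᶻ h x) ≡ Σℤ xs g -ᶻ Σℤ xs h
Σℤ-- []       g h = refl
Σℤ-- (x ∷ xs) g h rewrite Σℤ-- xs g h = lemma (g x) (h x) _ _
  where
  lemma : ∀ a b c d → a -ᶻ b +ᶻ (c -ᶻ d) ≡ a +ᶻ c -ᶻ (b +ᶻ d)
  lemma = solve-∀

Σℤ-*ˡ : ∀ {A : Set} (xs : List A) c g → Σℤ xs (λ x → c *ᶻ g x) ≡ c *ᶻ Σℤ xs g
Σℤ-*ˡ []       c g = sym (ℤ.*-zeroʳ c)
Σℤ-*ˡ (x ∷ xs) c g rewrite Σℤ-*ˡ xs c g = sym (ℤ.*-distribˡ-+ c (g x) _)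

Σℤ-*ʳ : ∀ {A : Set} (xs : List A) g c → Σℤ xs (λ x → g x *ᶻ c) ≡ Σℤ xs g *ᶻ c
Σℤ-*ʳ []       g c = sym (ℤ.*-zeroˡ c)
Σℤ-*ʳ (x ∷ xs) g c rewrite Σℤ-*ʳ xs g c = sym (ℤ.*-distribʳ-+ c (g x) _)

Σℤ-swap : ∀ {A B : Set} (xs : List A) (ys : List B) (g : A → B → ℤ) →
          Σℤ xs (λ x → Σℤ ys (g x)) ≡ Σℤ ys (λ y → Σℤ xs (λ x → g x y))
Σℤ-swap []       ys g = sym (Σℤ-zero ys)
Σℤ-swap (x ∷ xs) ys g = trans (cong (Σℤ ys (g x) +ᶻ_) (Σℤ-swap xs ys g)) (sym (Σℤ-+ ys (g x) _))

χ : Bool → ℤ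
χ b = if b then 1ℤ else 0ℤ

χ-∧ : ∀ a b → χ (a ∧ b) ≡ χ a *ᶻ χ b
χ-∧ true  b = sym (ℤ.*-identityˡ (χ b))
χ-∧ false b = sym (ℤ.*-zeroˡ (χ b))

Σℤ-filter : ∀ {A : Set} {P : A → Set} (P? : Decidable P) xs g →
            Σℤ (filter P? xs) g ≡ Σℤ xs (λ x → χ (does (P? x)) *ᶻ g x)
Σℤ-filter P? []       g = refl
Σℤ-filter P? (x ∷ xs) g with P? x
... | true  because _ = cong₂ _+ᶻ_ (sym (ℤ.*-identityˡ (g x))) (Σℤ-filter P? xs g)
... | false because _ = trans (Σℤ-filter P? xs g)
  (sym (trans (cong (_+ᶻ Σℤ xs (λ y → χ (does (P? y)) *ᶻ g y)) (ℤ.*-zeroˡ (g x))) (ℤ.+-identityˡ _)))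

-- Linear functionals on polynomials

coeff-+ₚ : ∀ p p′ m → coeff (p +ₚ p′) m ≡ coeff p m +ᶻ coeff p′ m
coeff-+ₚ []      p′       m       = sym (ℤ.+-identityˡ _)
coeff-+ₚ (a ∷ p) []       m       = sym (ℤ.+-identityʳ _)
coeff-+ₚ (a ∷ p) (b ∷ p′) zero    = refl
coeff-+ₚ (a ∷ p) (b ∷ p′) (suc m) = coeff-+ₚ p p′ m

coeff-map : ∀ (f : ℤ → ℤ) → f 0ℤ ≡ 0ℤ → ∀ p m → coeff (map f p) m ≡ f (coeff p m)
coeff-map f f0 []      m       = sym f0
coeff-map f f0 (a ∷ p) zero    = refl
coeff-map f f0 (a ∷ p) (suc m) = coeff-map f f0 p m

coeff--ₚ : ∀ p p′ m → coeff (p -ₚ p′) m ≡ coeff p m -ᶻ coeff p′ m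
coeff--ₚ p p′ m = trans (coeff-+ₚ p (map ℤ.-_ p′) m) (cong (coeff p m +ᶻ_) (coeff-map ℤ.-_ refl p′ m))

coeff-∷-*ₚ : ∀ a p p′ m → coeff ((a ∷ p) *ₚ p′) m ≡ a *ᶻ coeff p′ m +ᶻ coeff (0ℤ ∷ p *ₚ p′) m
coeff-∷-*ₚ a p p′ m = trans (coeff-+ₚ (map (a *ᶻ_) p′) (0ℤ ∷ p *ₚ p′) m)
  (cong (_+ᶻ coeff (0ℤ ∷ p *ₚ p′) m) (coeff-map (a *ᶻ_) (ℤ.*-zeroʳ a) p′ m))

record Linear (φ : Poly → ℤ) : Set where
  field
    respects-≈ : ∀ {p p′} → p ≈ p′ → φ p ≡ φ p′
    respects-0 : φ 0ₚ ≡ 0ℤ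
    respects-+ : ∀ p p′ → φ (p +ₚ p′) ≡ φ p +ᶻ φ p′

  respects-∑ : ∀ {A : Set} (xs : List A) g → φ (∑ xs g) ≡ Σℤ xs (φ ∘ g)
  respects-∑ []       g = respects-0
  respects-∑ (x ∷ xs) g = trans (respects-+ (g x) (∑ xs g)) (cong (φ (g x) +ᶻ_) (respects-∑ xs g))

  respects-- : ∀ p p′ → φ (p -ₚ p′) ≡ φ p -ᶻ φ p′
  respects-- p p′ = isolate (trans (sym (respects-+ (p -ₚ p′) p′)) (respects-≈ cancel))
    where
    cancel : (p -ₚ p′) +ₚ p′ ≈ p
    cancel m rewrite coeff-+ₚ (p -ₚ p′) p′ m | coeff--ₚ p p′ m = lemma (coeff p m) (coeff p′ m)
      where
      lemma : ∀ a b → a -ᶻ b +ᶻ b ≡ a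
      lemma = solve-∀
    isolate : ∀ {a b c} → a +ᶻ b ≡ c → a ≡ c -ᶻ b
    isolate {a} {b} refl = lemma a b
      where
      lemma : ∀ a b → a ≡ a +ᶻ b -ᶻ b
      lemma = solve-∀

open Linear public

coeff-linear : ∀ m → Linear (λ p → coeff p m)
coeff-linear m = record
  { respects-≈ = λ eq → eq m ; respects-0 = refl ; respects-+ = λ p p′ → coeff-+ₚ p p′ m }

*ₚ-congʳ : ∀ r {p p′} → p ≈ p′ → r *ₚ p ≈ r *ₚ p′
*ₚ-congʳ []      eq m = refl
*ₚ-congʳ (a ∷ r) {p} {p′} eq m rewrite coeff-∷-*ₚ a r p m | coeff-∷-*ₚ a r p′ m | eq m =
  cong (a *ᶻ coeff p′ m +ᶻ_) (shifted m)
  where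
  shifted : 0ℤ ∷ r *ₚ p ≈ 0ℤ ∷ r *ₚ p′
  shifted zero    = refl
  shifted (suc m) = *ₚ-congʳ r eq m

*ₚ-zeroʳ : ∀ r → r *ₚ 0ₚ ≈ 0ₚ
*ₚ-zeroʳ []      m       = refl
*ₚ-zeroʳ (a ∷ r) zero    = refl
*ₚ-zeroʳ (a ∷ r) (suc m) = *ₚ-zeroʳ r m

*ₚ-distribˡ : ∀ r p p′ → r *ₚ (p +ₚ p′) ≈ r *ₚ p +ₚ r *ₚ p′
*ₚ-distribˡ []      p p′ m = refl
*ₚ-distribˡ (a ∷ r) p p′ m
  rewrite coeff-+ₚ ((a ∷ r) *ₚ p) ((a ∷ r) *ₚ p′) m | coeff-∷-*ₚ a r (p +ₚ p′) m
        | coeff-∷-*ₚ a r p m | coeff-∷-*ₚ a r p′ m | coeff-+ₚ p p′ m =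
  trans (cong (a *ᶻ (coeff p m +ᶻ coeff p′ m) +ᶻ_) (shifted m)) (lemma a (coeff p m) (coeff p′ m) _ _)
  where
  shifted : ∀ m → coeff (0ℤ ∷ r *ₚ (p +ₚ p′)) m ≡ coeff (0ℤ ∷ r *ₚ p) m +ᶻ coeff (0ℤ ∷ r *ₚ p′) m
  shifted zero    = refl
  shifted (suc m) = trans (*ₚ-distribˡ r p p′ m) (coeff-+ₚ (r *ₚ p) (r *ₚ p′) m)
  lemma : ∀ a b c d e → a *ᶻ (b +ᶻ c) +ᶻ (d +ᶻ e) ≡ a *ᶻ b +ᶻ d +ᶻ (a *ᶻ c +ᶻ e)
  lemma = solve-∀

*ₚ-distribʳ : ∀ r p p′ → (p +ₚ p′) *ₚ r ≈ p *ₚ r +ₚ p′ *ₚ r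
*ₚ-distribʳ r []      p′       m = refl
*ₚ-distribʳ r (a ∷ p) []       m = sym (trans (coeff-+ₚ ((a ∷ p) *ₚ r) [] m) (ℤ.+-identityʳ _))
*ₚ-distribʳ r (a ∷ p) (b ∷ p′) m
  rewrite coeff-+ₚ ((a ∷ p) *ₚ r) ((b ∷ p′) *ₚ r) m | coeff-∷-*ₚ (a +ᶻ b) (p +ₚ p′) r m
        | coeff-∷-*ₚ a p r m | coeff-∷-*ₚ b p′ r m =
  trans (cong ((a +ᶻ b) *ᶻ coeff r m +ᶻ_) (shifted m)) (lemma a b (coeff r m) _ _)
  where
  shifted : ∀ m → coeff (0ℤ ∷ (p +ₚ p′) *ₚ r) m ≡ coeff (0ℤ ∷ p *ₚ r) m +ᶻ coeff (0ℤ ∷ p′ *ₚ r) m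
  shifted zero    = refl
  shifted (suc m) = trans (*ₚ-distribʳ r p p′ m) (coeff-+ₚ (p *ₚ r) (p′ *ₚ r) m)
  lemma : ∀ a b c d e → (a +ᶻ b) *ᶻ c +ᶻ (d +ᶻ e) ≡ a *ᶻ c +ᶻ d +ᶻ (b *ᶻ c +ᶻ e)
  lemma = solve-∀

module _ {φ : Poly → ℤ} (φ-linear : Linear φ) where

  *ₚ-linearʳ : ∀ r → Linear (λ p → φ (r *ₚ p))
  *ₚ-linearʳ r = record
    { respects-≈ = λ eq → respects-≈ φ-linear (*ₚ-congʳ r eq)
    ; respects-0 = trans (respects-≈ φ-linear (*ₚ-zeroʳ r)) (respects-0 φ-linear)
    ; respects-+ = λ p p′ → trans (respects-≈ φ-linear (*ₚ-distribˡ r p p′))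
                                  (respects-+ φ-linear (r *ₚ p) (r *ₚ p′))
    }

  ∑-*ₚ : ∀ {A : Set} (xs : List A) g r → φ (∑ xs g *ₚ r) ≡ Σℤ xs (λ x → φ (g x *ₚ r))
  ∑-*ₚ []       g r = respects-0 φ-linear
  ∑-*ₚ (x ∷ xs) g r = trans (respects-≈ φ-linear (*ₚ-distribʳ r (g x) (∑ xs g)))
    (trans (respects-+ φ-linear (g x *ₚ r) (∑ xs g *ₚ r)) (cong (φ (g x *ₚ r) +ᶻ_) (∑-*ₚ xs g r)))

q^-*ₚ : ∀ a b → q^ a *ₚ q^ b ≈ q^ (a + b)
q^-*ₚ zero    b m rewrite coeff-∷-*ₚ 1ℤ [] (q^ b) m = lemma m
  where
  lemma : ∀ m → 1ℤ *ᶻ coeff (q^ b) m +ᶻ coeff (0ℤ ∷ []) m ≡ coeff (q^ b) m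
  lemma zero    = trans (ℤ.+-identityʳ _) (ℤ.*-identityˡ _)
  lemma (suc m) = trans (ℤ.+-identityʳ _) (ℤ.*-identityˡ _)
q^-*ₚ (suc a) b m rewrite coeff-∷-*ₚ 0ℤ (q^ a) (q^ b) m | ℤ.*-zeroˡ (coeff (q^ b) m)
  | ℤ.+-identityˡ (coeff (0ℤ ∷ q^ a *ₚ q^ b) m) = lemma m
  where
  lemma : 0ℤ ∷ q^ a *ₚ q^ b ≈ q^ (suc a + b)
  lemma zero    = refl
  lemma (suc m) = q^-*ₚ a b m

-- Pattern containment as an order on words

-- `AllPairs` visits two positions in one order only, so both strict comparisons have to be
-- recorded.
SameOrder : ℕ × ℕ → ℕ × ℕ → Set
SameOrder (a , b) (a′ , b′) = (a < a′ ⇔ b < b′) × (a′ < a ⇔ b′ < b)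

<-sameOrder : ∀ {a b a′ b′} → a < a′ → b < b′ → SameOrder (a , b) (a′ , b′)
<-sameOrder p q = mk⇔ (λ _ → q) (λ _ → p) , mk⇔ (⊥-elim ∘ <-asym p) (⊥-elim ∘ <-asym q)

>-sameOrder : ∀ {a b a′ b′} → a′ < a → b′ < b → SameOrder (a , b) (a′ , b′)
>-sameOrder p q = mk⇔ (⊥-elim ∘ <-asym p) (⊥-elim ∘ <-asym q) , mk⇔ (λ _ → q) (λ _ → p)

-- The pairs match the letters of a subsequence of u with those of v.
infix 4 _≼_
_≼_ : List ℕ → List ℕ → Set
v ≼ u = ∃[ ps ] map proj₁ ps ⊆ u × map proj₂ ps ≡ v × AllPairs SameOrder ps

All-zip : ∀ {P : ℕ × ℕ → Set} w v .(eq : length w ≡ length v) →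
          (∀ i → P (lookup w i , lookup v (cast eq i))) → All P (zip w v)
All-zip []      []      eq h = []
All-zip (x ∷ w) (y ∷ v) eq h = h zero ∷ All-zip w v (suc-injective eq) (h ∘ suc)

≅⇒AllPairs : ∀ w v → w ≅ v → AllPairs SameOrder (zip w v)
≅⇒AllPairs []      []      _        = []
≅⇒AllPairs (x ∷ w) (y ∷ v) (eq , h) =
  All-zip w v (suc-injective eq) (λ i → h zero (suc i) , h (suc i) zero)
  ∷ ≅⇒AllPairs w v (suc-injective eq , λ i j → h (suc i) (suc j))

lookup-All : ∀ {P : ℕ × ℕ → Set} {ps} → All P ps →
             .(eq : length (map proj₁ ps) ≡ length (map proj₂ ps)) → ∀ i →
             P (lookup (map proj₁ ps) i , lookup (map proj₂ ps) (cast eq i))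
lookup-All (p ∷ _)  eq zero    = p
lookup-All (_ ∷ ps) eq (suc i) = lookup-All ps (suc-injective eq) i

AllPairs⇒≅ : ∀ ps → AllPairs SameOrder ps → map proj₁ ps ≅ map proj₂ ps
AllPairs⇒≅ ps r = eq ps , go r (eq ps)
  where
  eq : ∀ ps → length (map proj₁ ps) ≡ length (map {A = ℕ × ℕ} proj₂ ps)
  eq ps = trans (length-map proj₁ ps) (sym (length-map proj₂ ps))
  go : ∀ {ps} → AllPairs SameOrder ps →
       .(eq : length (map proj₁ ps) ≡ length (map proj₂ ps)) → ∀ i j →
       lookup (map proj₁ ps) i < lookup (map proj₁ ps) j ⇔
       lookup (map proj₂ ps) (cast eq i) < lookup (map proj₂ ps) (cast eq j)
  go (_ ∷ _) eq zero    zero    = mk⇔ (⊥-elim ∘ <-irrefl refl) (⊥-elim ∘ <-irrefl refl)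
  go (p ∷ _) eq zero    (suc j) = proj₁ (lookup-All p (suc-injective eq) j)
  go (p ∷ _) eq (suc i) zero    = proj₂ (lookup-All p (suc-injective eq) i)
  go (_ ∷ r) eq (suc i) (suc j) = go r (suc-injective eq) i j

Contains⇒≼ : ∀ {σ π} → σ Contains π → word π ≼ word σ
Contains⇒≼ {π = π} (w , w⊆σ , w≅π@(eq , _)) =
  zip w (word π) , subst (_⊆ _) (sym (map-proj₁ w (word π) eq)) w⊆σ ,
  map-proj₂ w (word π) eq , ≅⇒AllPairs w (word π) w≅π
  where
  map-proj₁ : ∀ (w v : List ℕ) → length w ≡ length v → map proj₁ (zip w v) ≡ w
  map-proj₁ []      []      _  = refl
  map-proj₁ (x ∷ w) (y ∷ v) eq = cong (x ∷_) (map-proj₁ w v (suc-injective eq))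
  map-proj₂ : ∀ (w v : List ℕ) → length w ≡ length v → map proj₂ (zip w v) ≡ v
  map-proj₂ []      []      _  = refl
  map-proj₂ (x ∷ w) (y ∷ v) eq = cong (y ∷_) (map-proj₂ w v (suc-injective eq))

≼⇒Contains : ∀ {σ π} → word π ≼ word σ → σ Contains π
≼⇒Contains (ps , ps⊆σ , eq , r) = map proj₁ ps , ps⊆σ , subst (map proj₁ ps ≅_) eq (AllPairs⇒≅ ps r)

⊆-map⁻ : ∀ {A B : Set} (f : A → B) {xs ys} → xs ⊆ map f ys → ∃[ zs ] zs ⊆ ys × map f zs ≡ xs
⊆-map⁻ f {ys = []}     []         = [] , [] , refl
⊆-map⁻ f {ys = y ∷ ys} (_ ∷ʳ s)   = map₂ (map₁ (y ∷ʳ_)) (⊆-map⁻ f s)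
⊆-map⁻ f {ys = y ∷ ys} (refl ∷ s) with ⊆-map⁻ f s
... | zs , s′ , refl = y ∷ zs , refl ∷ s′ , refl

AllPairs-resp-⊆ : ∀ {A : Set} {R : A → A → Set} {xs ys} → xs ⊆ ys → AllPairs R ys → AllPairs R xs
AllPairs-resp-⊆ []         []       = []
AllPairs-resp-⊆ (_ ∷ʳ s)   (_ ∷ rs) = AllPairs-resp-⊆ s rs
AllPairs-resp-⊆ (refl ∷ s) (r ∷ rs) = All.tabulate (All.lookup r ∘ Sublist.lookup s) ∷ AllPairs-resp-⊆ s rs

-- The letters of `v` used by `ps` single out a sublist `rs` of the pairs `qs`. Now `rs` and `ps`
-- share these letters as second and first components, and removing the shared component composes
-- the matchings.
≼-trans : ∀ {t v u} → t ≼ v → v ≼ u → t ≼ u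
≼-trans {u = u} (ps , ps⊆v , refl , r) (qs , qs⊆u , refl , s)
  with ⊆-map⁻ proj₂ ps⊆v
... | rs , rs⊆qs , eq =
  zs , ⊆-trans (subst (_⊆ _) (sym (fsts ps rs eq)) (Sublistₚ.map⁺ proj₁ rs⊆qs)) qs⊆u , snds ps rs eq ,
  compose-AllPairs ps rs eq r (AllPairs-resp-⊆ rs⊆qs s)
  where

  compose : ∀ ps rs → map proj₂ rs ≡ map proj₁ ps → List (ℕ × ℕ)
  compose []       []       eq = []
  compose (p ∷ ps) (r ∷ rs) eq = (proj₁ r , proj₂ p) ∷ compose ps rs (∷-injectiveʳ eq)
  fsts : ∀ ps rs eq → map proj₁ (compose ps rs eq) ≡ map proj₁ rs
  fsts []       []       eq = refl
  fsts (p ∷ ps) (r ∷ rs) eq = cong (_ ∷_) (fsts ps rs (∷-injectiveʳ eq))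
  snds : ∀ ps rs eq → map proj₂ (compose ps rs eq) ≡ map proj₂ ps
  snds []       []       eq = refl
  snds (p ∷ ps) (r ∷ rs) eq = cong (_ ∷_) (snds ps rs (∷-injectiveʳ eq))
  compose-All : ∀ p r ps rs eq → proj₂ r ≡ proj₁ p → All (SameOrder p) ps → All (SameOrder r) rs →
                All (SameOrder (proj₁ r , proj₂ p)) (compose ps rs eq)
  compose-All p r []       []       eq _    []      []      = []
  compose-All p r (q ∷ ps) (s ∷ rs) eq refl (h ∷ hs) (k ∷ ks) with ∷-injectiveˡ eq
  ... | refl = (proj₁ h ⇔-∘ proj₁ k , proj₂ h ⇔-∘ proj₂ k)
               ∷ compose-All p r ps rs (∷-injectiveʳ eq) refl hs ks
  compose-AllPairs : ∀ ps rs eq → AllPairs SameOrder ps → AllPairs SameOrder rs →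
                     AllPairs SameOrder (compose ps rs eq)
  compose-AllPairs []       []       eq []       []       = []
  compose-AllPairs (p ∷ ps) (r ∷ rs) eq (h ∷ hs) (k ∷ ks) =
    compose-All p r ps rs (∷-injectiveʳ eq) (∷-injectiveˡ eq) h k
    ∷ compose-AllPairs ps rs (∷-injectiveʳ eq) hs ks
  zs = compose ps rs eq

mapped-≼ : ∀ (g h : ℕ → ℕ) w →
           (∀ x y → g x < g y ⇔ h x < h y) → map h w ≼ map g w
mapped-≼ g h w same =
  map (λ x → g x , h x) w ,
  subst (_⊆ _) (map-∘ w) ⊆-refl , sym (map-∘ w) ,
  AllPairsₚ.map⁺ (universal w)
  where
  universal : ∀ w → AllPairs (λ x y → SameOrder (g x , h x) (g y , h y)) w
  universal []      = []
  universal (x ∷ w) = All.tabulate (λ {y} _ → same x y , same y x) ∷ universal w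

shift-≼ : ∀ c w → map (c +_) w ≼ w
shift-≼ c w = subst (map (c +_) w ≼_) (map-id w)
  (mapped-≼ (λ x → x) (c +_) w (λ x y → mk⇔ (+-monoʳ-< c) (+-cancelˡ-< c x y)))

≼-shift : ∀ c w → w ≼ map (c +_) w
≼-shift c w = subst (_≼ map (c +_) w) (map-id w)
  (mapped-≼ (c +_) (λ x → x) w (λ x y → mk⇔ (+-cancelˡ-< c x y) (+-monoʳ-< c)))

≼-refl : ∀ {w} → w ≼ w
≼-refl {w} = ≼-trans (≼-shift 0 w) (shift-≼ 0 w)

⊆⇒≼ : ∀ {v u} → v ⊆ u → v ≼ u
⊆⇒≼ v⊆u with ≼-refl
... | ps , s , eq , r = ps , ⊆-trans s v⊆u , eq , r


≼-length : ∀ {v u} → v ≼ u → length v ≤ length u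
≼-length (ps , s , refl , _) =
  ≤-trans (≤-reflexive (trans (length-map proj₂ ps) (sym (length-map proj₁ ps)))) (Sublistₚ.length-mono-≤ s)

-- Cutting an occurrence by position and by value

infix 4 _≪_
_≪_ : List ℕ → List ℕ → Set
u ≪ v = ∀ {x y} → x ∈ u → y ∈ v → x < y

⊆-++⁻ : ∀ {A : Set} {zs : List A} xs {ys} → zs ⊆ xs ++ ys →
        ∃₂ λ as bs → zs ≡ as ++ bs × as ⊆ xs × bs ⊆ ys
⊆-++⁻ []       s          = [] , _ , refl , [] , s
⊆-++⁻ (x ∷ xs) (_ ∷ʳ s)   with ⊆-++⁻ xs s
... | as , bs , eq , s₁ , s₂ = as , bs , eq , x ∷ʳ s₁ , s₂
⊆-++⁻ (x ∷ xs) (refl ∷ s) with ⊆-++⁻ xs s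
... | as , bs , eq , s₁ , s₂ = x ∷ as , bs , cong (x ∷_) eq , refl ∷ s₁ , s₂

map≡++⁻ : ∀ {A B : Set} (f : A → B) ps xs {ys} → map f ps ≡ xs ++ ys →
          ∃₂ λ as bs → ps ≡ as ++ bs × map f as ≡ xs × map f bs ≡ ys
map≡++⁻ f ps       []       eq = [] , ps , refl , refl , eq
map≡++⁻ f (p ∷ ps) (x ∷ xs) eq with map≡++⁻ f ps xs (∷-injectiveʳ eq)
... | as , bs , refl , eq₁ , eq₂ = p ∷ as , bs , refl , cong₂ _∷_ (∷-injectiveˡ eq) eq₁ , eq₂

AllPairs-++⁻ : ∀ {A : Set} {R : A → A → Set} xs {ys} → AllPairs R (xs ++ ys) →
               AllPairs R xs × AllPairs R ys × (∀ {x y} → x ∈ xs → y ∈ ys → R x y)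
AllPairs-++⁻ []       rs       = [] , rs , λ ()
AllPairs-++⁻ (x ∷ xs) (r ∷ rs) with AllPairs-++⁻ xs rs
... | r₁ , r₂ , h = Allₚ.++⁻ˡ xs r ∷ r₁ , r₂ , λ where
  (here refl) y∈ → All.lookup (Allₚ.++⁻ʳ xs r) y∈
  (there x∈)  y∈ → h x∈ y∈

-- Both value conditions are returned because both kinds of cut occur: in 213[σ₁,1,σ₂] the part
-- after σ₁⋆ lies above it, while in σ⋆ the final 1 lies below what precedes it.
≼-++⁻ : ∀ {v} a {b} → v ≼ a ++ b →
        ∃₂ λ v₁ v₂ → v ≡ v₁ ++ v₂ × v₁ ≼ a × v₂ ≼ b × (a ≪ b → v₁ ≪ v₂) × (b ≪ a → v₂ ≪ v₁)
≼-++⁻ a (ps , s , refl , r) with ⊆-++⁻ a s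
... | as , bs , eq , s₁ , s₂ with map≡++⁻ proj₁ ps as eq
... | ps₁ , ps₂ , refl , refl , refl with AllPairs-++⁻ ps₁ r
... | r₁ , r₂ , r₁₂ =
  map proj₂ ps₁ , map proj₂ ps₂ , map-++ proj₂ ps₁ ps₂ ,
  (ps₁ , s₁ , refl , r₁) , (ps₂ , s₂ , refl , r₂) , lt , gt
  where
  lt : _ → map proj₂ ps₁ ≪ map proj₂ ps₂
  lt a≪b x∈ y∈ with ∈-map⁻ proj₂ x∈ | ∈-map⁻ proj₂ y∈
  ... | p , p∈ , refl | q , q∈ , refl = Equivalence.to (proj₁ (r₁₂ p∈ q∈))
    (a≪b (Sublist.lookup s₁ (∈-map⁺ proj₁ p∈)) (Sublist.lookup s₂ (∈-map⁺ proj₁ q∈)))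
  gt : _ → map proj₂ ps₂ ≪ map proj₂ ps₁
  gt b≪a y∈ x∈ with ∈-map⁻ proj₂ x∈ | ∈-map⁻ proj₂ y∈
  ... | p , p∈ , refl | q , q∈ , refl = Equivalence.to (proj₂ (r₁₂ p∈ q∈))
    (b≪a (Sublist.lookup s₂ (∈-map⁺ proj₁ q∈)) (Sublist.lookup s₁ (∈-map⁺ proj₁ p∈)))

≼-++⁺ : ∀ {v₁ v₂ a b} → (v₁ ≪ v₂ × a ≪ b) ⊎ (v₂ ≪ v₁ × b ≪ a) →
        v₁ ≼ a → v₂ ≼ b → v₁ ++ v₂ ≼ a ++ b
≼-++⁺ o (ps , s , refl , r) (qs , t , refl , u) =
  ps ++ qs , subst (_⊆ _) (sym (map-++ proj₁ ps qs)) (Sublistₚ.++⁺ s t) , map-++ proj₂ ps qs ,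
  AllPairsₚ.++⁺ r u (All.tabulate λ p∈ → All.tabulate λ q∈ → cross o p∈ q∈)
  where
  cross : _ → ∀ {p q} → p ∈ ps → q ∈ qs → SameOrder p q
  cross (inj₁ (v≪ , a≪)) p∈ q∈ = <-sameOrder m n
    where
    m = a≪ (Sublist.lookup s (∈-map⁺ proj₁ p∈)) (Sublist.lookup t (∈-map⁺ proj₁ q∈))
    n = v≪ (∈-map⁺ proj₂ p∈) (∈-map⁺ proj₂ q∈)
  cross (inj₂ (v≪ , a≪)) p∈ q∈ = >-sameOrder m n
    where
    m = a≪ (Sublist.lookup t (∈-map⁺ proj₁ q∈)) (Sublist.lookup s (∈-map⁺ proj₁ p∈))
    n = v≪ (∈-map⁺ proj₂ q∈) (∈-map⁺ proj₂ p∈)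

-- Containment in 213[σ₁,1,σ₂] of a ⊕-sum of blocks π⋆

infixr 5 _⊕_
_⊕_ : List ℕ → List ℕ → List ℕ
u ⊕ v = u ++ map (length u +_) v

Bounded : List ℕ → Set
Bounded w = ∀ {x} → x ∈ w → 1 ≤ x × x ≤ length w

bounded : ∀ σ → Bounded (word σ)
bounded σ = All.lookup (perm⇒bounded (isPermutation σ))

≪-shift : ∀ {u v c} → Bounded u → Bounded v → length u ≤ c → u ≪ map (c +_) v
≪-shift {c = c} bu bv ≤c x∈ y∈ with ∈-map⁻ (c +_) y∈
... | y , y∈v , refl = ≤-<-trans (≤-trans (proj₂ (bu x∈)) ≤c) (m<m+n c (proj₁ (bv y∈v)))

infix 9 _⋆ʷ
_⋆ʷ : List ℕ → List ℕ
w ⋆ʷ = map suc w ++ 1 ∷ []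

word-⋆ : ∀ σ → word (σ ⋆) ≡ word σ ⋆ʷ
word-⋆ σ = refl

⋆ʷ-bounded : ∀ σ → Bounded (word σ ⋆ʷ)
⋆ʷ-bounded σ = subst Bounded (word-⋆ σ) (bounded (σ ⋆))

length-⋆ʷ : ∀ w → length (w ⋆ʷ) ≡ length w + 1
length-⋆ʷ w = trans (length-++ (map suc w)) (cong (_+ 1) (length-map suc w))

-- The shift ∣σ₁∣ + 1 is what `offset` computes for the label 3: below that block lie σ₁ and the
-- single letter. Only reassociation is left.
word-213 : ∀ σ₁ σ₂ → word 213[ σ₁ ,1, σ₂ ] ≡ word σ₁ ⋆ʷ ++ map (∣ σ₁ ∣ + 1 +_) (word σ₂)
word-213 σ₁ σ₂ =
  trans (cong (λ b → map suc (word σ₁) ++ 1 ∷ b) (++-identityʳ _))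
        (sym (++-assoc (map suc (word σ₁)) (1 ∷ []) _))

module _ (t₀ : ℕ) (σ₀ : 𝔖) where

  offset-∷-< : ∀ ps {t} → t₀ < t → offset ((t₀ , σ₀) ∷ ps) t ≡ ∣ σ₀ ∣ + offset ps t
  offset-∷-< ps t₀<t = cong (sum ∘ map (∣_∣ ∘ proj₂))
    (filter-accept (λ p → proj₁ p <? _) {x = t₀ , σ₀} {xs = ps} t₀<t)

  offset-minimum : ∀ {ps} → All (λ p → t₀ < proj₁ p) ps → offset ((t₀ , σ₀) ∷ ps) t₀ ≡ 0
  offset-minimum h = cong (sum ∘ map (∣_∣ ∘ proj₂))
    (filter-none (λ p → proj₁ p <? t₀) (<-irrefl refl ∷ All.map <-asym h))

  -- The block with the least label lies at the bottom: its own offset is 0, and it raises every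
  -- other offset by its size.
  inflateWord-∷ : ∀ {ps} → All (λ p → t₀ < proj₁ p) ps →
                  inflateWord ((t₀ , σ₀) ∷ ps) ≡ word σ₀ ⊕ inflateWord ps
  inflateWord-∷ {ps} h = cong₂ _++_
    (trans (cong (λ c → map (c +_) (word σ₀)) (offset-minimum h)) (map-id (word σ₀)))
    (blocks h)
    where
    blocks : ∀ {qs} → All (λ p → t₀ < proj₁ p) qs →
             concat (map (block ((t₀ , σ₀) ∷ ps)) qs) ≡ map (∣ σ₀ ∣ +_) (concat (map (block ps) qs))
    blocks []               = refl
    blocks {(t , σ) ∷ qs} (t₀<t ∷ h) = trans
      (cong₂ _++_
        (trans (map-cong (λ x → trans (cong (_+ x) (offset-∷-< ps t₀<t)) (+-assoc ∣ σ₀ ∣ _ x)) (word σ))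
               (map-∘ (word σ)))
        (blocks h))
      (sym (map-++ (∣ σ₀ ∣ +_) (block ps (t , σ)) _))

⨁ : List 𝔖 → List ℕ
⨁ []       = []
⨁ (σ ∷ σs) = word σ ⊕ ⨁ σs

-- Only the order of the labels matters. They are an arbitrary increasing `g` because the tail of 1,
-- ..., r is not of the form 1, ..., r - 1, and the induction has to pass to it.
inflateWord-increasing : ∀ (g : ℕ → ℕ) → (∀ {i j} → i < j → g i < g j) → ∀ σs →
                         inflateWord (zip (applyUpTo g (length σs)) σs) ≡ ⨁ σs
inflateWord-increasing g mono []       = refl
inflateWord-increasing g mono (σ ∷ σs) = trans
  (inflateWord-∷ (g 0) σ (later (g ∘ suc) (λ i → mono (s≤s z≤n)) σs))
  (cong (word σ ⊕_) (inflateWord-increasing (g ∘ suc) (mono ∘ s≤s) σs))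
  where
  later : ∀ (h : ℕ → ℕ) → (∀ i → g 0 < h i) → ∀ (τs : List 𝔖) →
          All (λ p → g 0 < proj₁ p) (zip (applyUpTo h (length τs)) τs)
  later h lt []       = []
  later h lt (τ ∷ τs) = lt 0 ∷ later (h ∘ suc) (lt ∘ suc) τs

word-ι : ∀ σs → word ι[ σs ] ≡ ⨁ σs
word-ι = inflateWord-increasing suc s≤s

⨁⋆ : List 𝔖 → List ℕ
⨁⋆ []       = []
⨁⋆ (π ∷ πs) = word π ⋆ʷ ⊕ ⨁⋆ πs

word-ι⋆ : ∀ πs → word ι[ map _⋆ πs ] ≡ ⨁⋆ πs
word-ι⋆ πs = trans (word-ι (map _⋆ πs)) (go πs)
  where
  go : ∀ πs → ⨁ (map _⋆ πs) ≡ ⨁⋆ πs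
  go []       = refl
  go (π ∷ πs) = cong₂ _⊕_ (word-⋆ π) (go πs)

⨁⋆-bounded : ∀ πs → Bounded (⨁⋆ πs)
⨁⋆-bounded πs = subst Bounded (word-ι⋆ πs) (bounded ι[ map _⋆ πs ])

-- In the second case the overlap is nonempty: `as` reaches strictly past the cut, so its last
-- letter falls into the right-hand part `ds`.
++-compare : ∀ {A : Set} (as cs : List A) {bs ds} → as ++ bs ≡ cs ++ ds →
             (∃[ es ] cs ≡ as ++ es × bs ≡ es ++ ds) ⊎
             (∃₂ λ e es → as ≡ cs ++ e ∷ es × ds ≡ e ∷ es ++ bs)
++-compare []       cs       eq = inj₁ (cs , refl , eq)
++-compare (a ∷ as) []       eq = inj₂ (a , as , refl , sym eq)
++-compare (a ∷ as) (c ∷ cs) eq with ∷-injectiveˡ eq | ++-compare as cs (∷-injectiveʳ eq)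
... | refl | inj₁ (es , eq₁ , eq₂)     = inj₁ (es , cong (a ∷_) eq₁ , eq₂)
... | refl | inj₂ (e , es , eq₁ , eq₂) = inj₂ (e , es , cong (a ∷_) eq₁ , eq₂)

last-∈ : ∀ {A : Set} ws {z : A} as {e es} → ws ++ z ∷ [] ≡ as ++ e ∷ es → z ∈ e ∷ es
last-∈ ws       []       eq = subst (_ ∈_) eq (∈-++⁺ʳ ws (here refl))
last-∈ (w ∷ ws) (a ∷ as) eq = last-∈ ws as (∷-injectiveʳ eq)
last-∈ []       (a ∷ as) eq with ++-conicalʳ as _ (sym (∷-injectiveʳ eq))
... | ()

-- A cut of a ⊕-sum at which the values also separate is a cut between two
-- summands, because a summand ends with its smallest letter.
cut : ∀ πs v₁ v₂ → ⨁⋆ πs ≡ v₁ ++ v₂ → v₁ ≪ v₂ →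
      ∃[ i ] i ≤ length πs × v₁ ≡ ⨁⋆ (take i πs) ×
             ∃[ c ] v₂ ≡ map (c +_) (⨁⋆ (drop i πs))
cut πs       []       v₂ eq _  = 0 , z≤n , refl , 0 , trans (sym eq) (sym (map-id _))
cut (π ∷ πs) (x ∷ v₁) v₂ eq lt with ++-compare (word π ⋆ʷ) (x ∷ v₁) eq
-- The cut falls inside the first summand, with `x` before it and the final 1 after it; the
-- separation of values would give x < 1.
... | inj₂ (e , es , eq₁ , refl) = ⊥-elim (≤⇒≯ 1≤x x<1)
  where
  1≤x = proj₁ (⋆ʷ-bounded π (subst (x ∈_) (sym eq₁) (here refl)))
  x<1 = lt (here refl) (∈-++⁺ˡ (last-∈ (map suc (word π)) (x ∷ v₁) eq₁))
... | inj₁ (es , eq₁ , eq₂) with map≡++⁻ (length (word π ⋆ʷ) +_) _ es eq₂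
... | d₁ , d₂ , eq₃ , refl , refl
  with cut πs d₁ d₂ eq₃ (λ p q → +-cancelˡ-< (length (word π ⋆ʷ)) _ _
    (lt (subst (_ ∈_) (sym eq₁) (∈-++⁺ʳ (word π ⋆ʷ) (∈-map⁺ _ p))) (∈-map⁺ _ q)))
... | i , i≤ , refl , c , refl =
  suc i , s≤s i≤ , eq₁ , length (word π ⋆ʷ) + c ,
  trans (sym (map-∘ _)) (map-cong (λ x → sym (+-assoc (length (word π ⋆ʷ)) c x)) _)

⨁⋆-take-drop : ∀ i πs → ∃[ c ] length (⨁⋆ (take i πs)) ≤ c ×
               ⨁⋆ πs ≡ ⨁⋆ (take i πs) ++ map (c +_) (⨁⋆ (drop i πs))
⨁⋆-take-drop zero    πs       = 0 , z≤n , sym (map-id _)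
⨁⋆-take-drop (suc i) []       = 0 , z≤n , refl
⨁⋆-take-drop (suc i) (π ∷ πs) with ⨁⋆-take-drop i πs
... | c , ≤c , eq = l + c , ≤c′ , eq′
  where
  open ≡-Reasoning
  w = word π ⋆ʷ
  l = length w
  A = ⨁⋆ (take i πs)
  B = ⨁⋆ (drop i πs)
  ≤c′ : length (w ⊕ A) ≤ l + c
  ≤c′ = ≤-trans (≤-reflexive (trans (length-++ w) (cong (l +_) (length-map _ A)))) (+-monoʳ-≤ l ≤c)
  eq′ : w ⊕ ⨁⋆ πs ≡ (w ⊕ A) ++ map (l + c +_) B
  eq′ = begin
    w ⊕ ⨁⋆ πs                                          ≡⟨ cong (w ⊕_) eq ⟩
    w ⊕ (A ++ map (c +_) B)                            ≡⟨ cong (w ++_) (map-++ _ A _) ⟩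
    w ++ map (l +_) A ++ map (l +_) (map (c +_) B)     ≡⟨ sym (++-assoc w _ _) ⟩
    (w ⊕ A) ++ map (l +_) (map (c +_) B)
      ≡⟨ cong ((w ⊕ A) ++_) (trans (sym (map-∘ B)) (map-cong (λ x → sym (+-assoc l c x)) B)) ⟩
    (w ⊕ A) ++ map (l + c +_) B                        ∎

⋆ʷ≪shift : ∀ σ₁ σ₂ → word σ₁ ⋆ʷ ≪ map (∣ σ₁ ∣ + 1 +_) (word σ₂)
⋆ʷ≪shift σ₁ σ₂ = ≪-shift (⋆ʷ-bounded σ₁) (bounded σ₂) (≤-reflexive (length-⋆ʷ (word σ₁)))

≼-213⁻ : ∀ {v} σ₁ σ₂ → v ≼ word 213[ σ₁ ,1, σ₂ ] →
         ∃₂ λ v₁ v₂ → v ≡ v₁ ++ v₂ × v₁ ≼ word σ₁ ⋆ʷ × v₂ ≼ word σ₂ × v₁ ≪ v₂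
≼-213⁻ {v} σ₁ σ₂ e with ≼-++⁻ (word σ₁ ⋆ʷ) (subst (v ≼_) (word-213 σ₁ σ₂) e)
... | v₁ , v₂ , eq , e₁ , e₂ , lt , _ =
  v₁ , v₂ , eq , e₁ , ≼-trans e₂ (shift-≼ _ _) , lt (⋆ʷ≪shift σ₁ σ₂)

⨁⋆-≼-213⁻ : ∀ πs σ₁ σ₂ → ⨁⋆ πs ≼ word 213[ σ₁ ,1, σ₂ ] →
            ∃[ i ] i ≤ length πs × ⨁⋆ (take i πs) ≼ word σ₁ ⋆ʷ × ⨁⋆ (drop i πs) ≼ word σ₂
⨁⋆-≼-213⁻ πs σ₁ σ₂ e with ≼-213⁻ σ₁ σ₂ e
... | v₁ , v₂ , eq , e₁ , e₂ , lt with cut πs v₁ v₂ eq lt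
... | i , i≤ , refl , c , refl = i , i≤ , e₁ , ≼-trans (≼-shift c _) e₂

⨁⋆-≼-213⁺ : ∀ πs σ₁ σ₂ i → ⨁⋆ (take i πs) ≼ word σ₁ ⋆ʷ → ⨁⋆ (drop i πs) ≼ word σ₂ →
            ⨁⋆ πs ≼ word 213[ σ₁ ,1, σ₂ ]
⨁⋆-≼-213⁺ πs σ₁ σ₂ i e₁ e₂ with ⨁⋆-take-drop i πs
... | c , ≤c , eq = subst₂ _≼_ (sym eq) (sym (word-213 σ₁ σ₂))
  (≼-++⁺ (inj₁ (≪-shift (⨁⋆-bounded (take i πs)) (⨁⋆-bounded (drop i πs)) ≤c , ⋆ʷ≪shift σ₁ σ₂))
    e₁ (≼-trans (shift-≼ c _) (≼-trans e₂ (≼-shift _ _))))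

-- The role of the final letter of σ⋆

1≪ : ∀ σ → 1 ∷ [] ≪ map suc (word σ)
1≪ σ (here refl) y∈ with ∈-map⁻ suc y∈
... | _ , y∈σ , refl = s≤s (proj₁ (bounded σ y∈σ))

⋆ʷ-mono : ∀ π σ → word π ≼ word σ → word π ⋆ʷ ≼ word σ ⋆ʷ
⋆ʷ-mono π σ e = ≼-++⁺ (inj₂ (1≪ π , 1≪ σ))
  (≼-trans (shift-≼ 1 (word π)) (≼-trans e (≼-shift 1 (word σ)))) ≼-refl

⋆ʷ-increasing : ∀ w → w ≼ w ⋆ʷ
⋆ʷ-increasing w = ≼-trans (≼-shift 1 w) (⊆⇒≼ (Sublistₚ.++⁺ʳ _ ⊆-refl))

-- The smallest letter, which ends σ ⋆, can only be matched by a final letter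
-- that lies below all the letters before it.
≼-⋆ʷ⁻ : ∀ {v} σ → v ≼ word σ ⋆ʷ →
        v ≼ word σ ⊎ (∃₂ λ w y → v ≡ w ++ y ∷ [] × w ≼ word σ × y ∷ [] ≪ w)
≼-⋆ʷ⁻ {v} σ e with ≼-++⁻ (map suc (word σ)) e
... | w , []        , refl , e₁ , _ , _ =
  inj₁ (subst (_≼ word σ) (sym (++-identityʳ w)) (≼-trans e₁ (shift-≼ 1 _)))
... | w , y ∷ []    , eq   , e₁ , _ , _ , gt =
  inj₂ (w , y , eq , ≼-trans e₁ (shift-≼ 1 _) , gt (1≪ σ))
... | w , _ ∷ _ ∷ _ , _    , _ , e₂ , _ with ≼-length e₂
... | s≤s ()

⋆ʷ-cancel : ∀ w σ → w ⋆ʷ ≼ word σ ⋆ʷ → w ≼ word σ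
⋆ʷ-cancel w σ e with ≼-⋆ʷ⁻ σ e
... | inj₁ e′                = ≼-trans (⋆ʷ-increasing w) e′
... | inj₂ (w′ , y , eq , e′ , _) with ∷ʳ-injectiveˡ (map suc w) w′ eq
... | refl = ≼-trans (≼-shift 1 w) e′

-- With at least two blocks the last letter is not the smallest, since the 1 ending the first block
-- comes before it. Hence it cannot be matched with the final 1 of σ⋆.
⨁⋆-∷∷-≼-⋆ʷ⁻ : ∀ π₁ π₂ πs σ → ⨁⋆ (π₁ ∷ π₂ ∷ πs) ≼ word σ ⋆ʷ → ⨁⋆ (π₁ ∷ π₂ ∷ πs) ≼ word σ
⨁⋆-∷∷-≼-⋆ʷ⁻ π₁ π₂ πs σ e with ≼-⋆ʷ⁻ σ e
... | inj₁ e′                     = e′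
... | inj₂ (w , y , eq , _ , y≪w) with ++-compare (word π₁ ⋆ʷ) w eq
...   | inj₁ (es , refl , _) = ⊥-elim (≤⇒≯ 1≤y (y≪w (here refl) 1∈w))
  where
  1∈w = ∈-++⁺ˡ (∈-++⁺ʳ (map suc (word π₁)) (here refl))
  1≤y = proj₁ (⨁⋆-bounded (π₁ ∷ π₂ ∷ πs) (subst (y ∈_) (sym eq) (∈-++⁺ʳ w (here refl))))
-- Here the first block would exhaust the whole word, yet the second block contributes at least one
-- letter.
...   | inj₂ (_ , es , _ , eq′) with subst (_ ∈_) (++-conicalʳ es _ (sym (∷-injectiveʳ eq′)))
                                 (∈-map⁺ _ (∈-++⁺ˡ (∈-++⁺ʳ (map suc (word π₂)) (here refl))))
...     | ()

-- `lower πs 1` is π₁ and not π₁⋆; the missing final 1 is supplied by that of σ⋆. From the second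
-- index on, the occurrence lies in σ, which occurs in σ⋆.
lower-≼⁺ : ∀ πs {j} σ → j < length πs →
           word (lower πs (suc j)) ≼ word σ → ⨁⋆ (take (suc j) πs) ≼ word σ ⋆ʷ
lower-≼⁺ (π ∷ πs)       {zero}  σ _ e = subst (_≼ word σ ⋆ʷ) (sym (++-identityʳ _)) (⋆ʷ-mono π σ e)
lower-≼⁺ (π₁ ∷ π₂ ∷ πs) {suc j} σ _ e =
  ≼-trans (subst (_≼ word σ) (word-ι⋆ (π₁ ∷ π₂ ∷ take j πs)) e) (⋆ʷ-increasing (word σ))
lower-≼⁺ (π ∷ [])       {suc j} σ (s≤s ()) e

-- The bound on `j` matters: for a single block π and j = 1 the premise π⋆ ≼ σ⋆ says only that π
-- occurs in σ, whereas `lower` would ask for π⋆.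
lower-≼⁻ : ∀ πs {j} σ → j < length πs →
           ⨁⋆ (take (suc j) πs) ≼ word σ ⋆ʷ → word (lower πs (suc j)) ≼ word σ
lower-≼⁻ (π ∷ πs)       {zero}  σ _ e = ⋆ʷ-cancel (word π) σ (subst (_≼ word σ ⋆ʷ) (++-identityʳ _) e)
lower-≼⁻ (π₁ ∷ π₂ ∷ πs) {suc j} σ _ e =
  subst (_≼ word σ) (sym (word-ι⋆ (π₁ ∷ π₂ ∷ take j πs))) (⨁⋆-∷∷-≼-⋆ʷ⁻ π₁ π₂ (take j πs) σ e)
lower-≼⁻ (π ∷ [])       {suc j} σ (s≤s ()) e

⨁⋆-take-⊆ : ∀ i πs → ⨁⋆ (take i πs) ⊆ ⨁⋆ (take (suc i) πs)
⨁⋆-take-⊆ zero    πs       = minimum _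
⨁⋆-take-⊆ (suc i) []       = []
⨁⋆-take-⊆ (suc i) (π ∷ πs) = Sublistₚ.++⁺ ⊆-refl (Sublistₚ.map⁺ _ (⨁⋆-take-⊆ i πs))

-- Apart from the first step these are sums over longer and longer prefixes of `πs`. The first step
-- goes from π₁ through π₁⋆, because `lower` omits the star at index 1.
lower-mono : ∀ πs j → word (lower πs (suc j)) ≼ word (lower πs (suc (suc j)))
lower-mono []       j       = subst₂ _≼_ (sym (word-ι⋆ [])) (sym (word-ι⋆ [])) ≼-refl
lower-mono (π ∷ πs) zero    = ≼-trans (⋆ʷ-increasing (word π))
  (subst (word π ⋆ʷ ≼_) (sym (word-ι⋆ (π ∷ take 1 πs))) (⊆⇒≼ (Sublistₚ.++⁺ʳ _ ⊆-refl)))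
lower-mono (π ∷ πs) (suc j) = subst₂ _≼_
  (sym (word-ι⋆ (take (2 + j) (π ∷ πs)))) (sym (word-ι⋆ (take (3 + j) (π ∷ πs))))
  (⊆⇒≼ (⨁⋆-take-⊆ (2 + j) (π ∷ πs)))

⨁⋆-drop-≼ : ∀ i πs → ⨁⋆ (drop (suc i) πs) ≼ ⨁⋆ (drop i πs)
⨁⋆-drop-≼ zero    []       = ≼-refl
⨁⋆-drop-≼ zero    (π ∷ πs) = ≼-trans (≼-shift _ _) (⊆⇒≼ (Sublistₚ.++⁺ˡ (word π ⋆ʷ) ⊆-refl))
⨁⋆-drop-≼ (suc i) []       = ≼-refl
⨁⋆-drop-≼ (suc i) (π ∷ πs) = ⨁⋆-drop-≼ i πs

upper-anti : ∀ πs j → word (upper πs (suc (suc j))) ≼ word (upper πs (suc j))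
upper-anti πs j = subst₂ _≼_ (sym (word-ι⋆ (drop (suc j) πs))) (sym (word-ι⋆ (drop j πs))) (⨁⋆-drop-≼ j πs)

-- The signed count of avoided blocks

module _ (a b : ℕ → Bool) where

  -- With a j for "σ₁ avoids lower (j + 1)" and b j for "σ₂ avoids upper (j + 1)",
  -- separated s ∧ a s holds iff no cut of the s + 1 blocks of π embeds π.
  separated : ℕ → Bool
  separated zero    = b 0
  separated (suc s) = separated s ∧ (a s ∨ b (suc s))

  separated⁻ : ∀ s → separated s ≡ true → b 0 ≡ true × (∀ {j} → j < s → a j ∨ b (suc j) ≡ true)
  separated⁻ zero    h = h , λ ()
  separated⁻ (suc s) h with separated s in eq | a s ∨ b (suc s) in eq′
  ... | true | true = proj₁ (separated⁻ s eq) , λ j<1+s → case-≤ (m≤n⇒m<n∨m≡n (≤-pred j<1+s))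
    where
    case-≤ : ∀ {j} → j < s ⊎ j ≡ s → a j ∨ b (suc j) ≡ true
    case-≤ (inj₁ j<s)  = proj₂ (separated⁻ s eq) j<s
    case-≤ (inj₂ refl) = eq′

  separated-false⁻ : ∀ s → separated s ≡ false →
                     b 0 ≡ false ⊎ (∃[ j ] j < s × a j ≡ false × b (suc j) ≡ false)
  separated-false⁻ zero    h = inj₁ h
  separated-false⁻ (suc s) h with separated s in eq | a s in eq₁ | b (suc s) in eq₂
  ... | true  | false | false = inj₂ (s , n<1+n s , eq₁ , eq₂)
  ... | false | _     | _     with separated-false⁻ s eq
  ...   | inj₁ b0               = inj₁ b0
  ...   | inj₂ (j , j<s , rest) = inj₂ (j , m<n⇒m<1+n j<s , rest)

  separated∧-true⁻ : ∀ s → separated s ∧ a s ≡ true →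
                     b 0 ≡ true × (∀ {j} → j < s → a j ≡ false → b (suc j) ≡ true) × a s ≡ true
  separated∧-true⁻ s h with separated s in eq | a s in eq′
  ... | true | true = proj₁ (separated⁻ s eq) , resolve , refl
    where
    resolve : ∀ {j} → j < s → a j ≡ false → b (suc j) ≡ true
    resolve {j} j<s aj = subst (λ c → c ∨ b (suc j) ≡ true) aj (proj₂ (separated⁻ s eq) j<s)

  separated∧-false⁻ : ∀ s → separated s ∧ a s ≡ false →
                      b 0 ≡ false ⊎ (∃[ j ] j < s × a j ≡ false × b (suc j) ≡ false) ⊎ a s ≡ false
  separated∧-false⁻ s h with separated s in eq
  ... | true = inj₂ (inj₂ h)
  ... | false with separated-false⁻ s eq
  ...   | inj₁ b0 = inj₁ b0
  ...   | inj₂ r  = inj₂ (inj₁ r)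

  module _ (a-mono : ∀ j → a j ≡ true → a (suc j) ≡ true)
           (b-anti : ∀ j → b (suc j) ≡ true → b j ≡ true) where

    -- By `b-anti` all earlier `b j` hold as well, so each disjunction in `separated` holds through
    -- its right member.
    b⇒separated : ∀ s → b s ≡ true → separated s ≡ true
    b⇒separated zero    h = h
    b⇒separated (suc s) h rewrite h | b⇒separated s (b-anti s h) = ∨-zeroʳ (a s)

    -- `a` turns from false to true and `b` from true to false, so the indices where both hold form
    -- an interval, and a j ∧ b (j + 1) marks its pairs of neighbours. Points minus neighbouring
    -- pairs give 1 for a nonempty interval and 0 for an empty one; `separated s ∧ a s` says that it
    -- is nonempty.
    telescope : ∀ s → Σℤ (applyUpTo suc (suc s)) (λ i → χ (a (pred i) ∧ b (pred i))) ≡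
                χ (separated s ∧ a s) +ᶻ Σℤ (applyUpTo suc s) (λ i → χ (a (pred i) ∧ b i))
    telescope zero = cong (λ c → χ c +ᶻ 0ℤ) (∧-comm (a 0) (b 0))
    telescope (suc s) = begin
      Σℤ (applyUpTo suc (2 + s)) g
        ≡⟨ snoc g (suc s) ⟩
      Σℤ (applyUpTo suc (suc s)) g +ᶻ g (2 + s)
        ≡⟨ cong (_+ᶻ g (2 + s)) (telescope s) ⟩
      χ (separated s ∧ a s) +ᶻ H +ᶻ g (2 + s)
        ≡⟨ lemma₁ (χ (separated s ∧ a s)) H (g (2 + s)) ⟩
      χ (separated s ∧ a s) +ᶻ g (2 + s) +ᶻ H
        ≡⟨ cong (_+ᶻ H) step ⟩
      χ (separated (suc s) ∧ a (suc s)) +ᶻ h (suc s) +ᶻ H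
        ≡⟨ lemma₂ (χ (separated (suc s) ∧ a (suc s))) H (h (suc s)) ⟩
      χ (separated (suc s) ∧ a (suc s)) +ᶻ (H +ᶻ h (suc s))
        ≡⟨ cong (χ (separated (suc s) ∧ a (suc s)) +ᶻ_) (sym (snoc h s)) ⟩
      χ (separated (suc s) ∧ a (suc s)) +ᶻ Σℤ (applyUpTo suc (suc s)) h ∎
      where
      open ≡-Reasoning
      g h : ℕ → ℤ
      g i = χ (a (pred i) ∧ b (pred i))
      h i = χ (a (pred i) ∧ b i)
      H = Σℤ (applyUpTo suc s) h
      snoc : ∀ (k : ℕ → ℤ) n → Σℤ (applyUpTo suc (suc n)) k ≡ Σℤ (applyUpTo suc n) k +ᶻ k (suc n)
      snoc k n = trans (cong (λ is → Σℤ is k) (sym (applyUpTo-∷ʳ suc n)))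
        (trans (Σℤ-++ (applyUpTo suc n) (suc n ∷ []) k) (cong (Σℤ (applyUpTo suc n) k +ᶻ_) (ℤ.+-identityʳ _)))
      lemma₁ : ∀ x y z → x +ᶻ y +ᶻ z ≡ x +ᶻ z +ᶻ y
      lemma₁ = solve-∀
      lemma₂ : ∀ x y z → x +ᶻ z +ᶻ y ≡ x +ᶻ (y +ᶻ z)
      lemma₂ = solve-∀
      -- One product is added on each side. If `a s` holds, so does `a (suc s)`, and the new
      -- conjunct of `separated` is true. Otherwise that conjunct is `b (suc s)`; if it holds, then
      -- `separated s` holds too, and if not, all terms vanish.
      step : χ (separated s ∧ a s) +ᶻ χ (a (suc s) ∧ b (suc s)) ≡
             χ (separated (suc s) ∧ a (suc s)) +ᶻ χ (a s ∧ b (suc s))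
      step with a s in eq
      ... | true  rewrite a-mono s eq | ∧-identityʳ (separated s) | ∧-identityʳ (separated s) = refl
      ... | false with b (suc s) in eq′
      ...   | false rewrite ∧-zeroʳ (separated s) | ∧-zeroʳ (a (suc s)) = refl
      ...   | true  rewrite b⇒separated s (b-anti s eq′) | ∧-identityʳ (a (suc s)) =
        trans (ℤ.+-identityˡ (χ (a (suc s)))) (sym (ℤ.+-identityʳ (χ (a (suc s)))))

-- Opaque because normalising the decision procedure makes conversion checking explode.
opaque
  avoids : 𝔖 → 𝔖 → Bool
  avoids σ π = does (σ Avoids? π)

  does-Avoids? : ∀ σ π → does (σ Avoids? π) ≡ avoids σ π
  does-Avoids? σ π = refl

avoids-true⁺ : ∀ σ π → ¬ word π ≼ word σ → avoids σ π ≡ true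
avoids-true⁺ σ π h = trans (sym (does-Avoids? σ π)) (dec-true (σ Avoids? π) (h ∘ Contains⇒≼ {σ} {π}))

avoids-false⁺ : ∀ σ π → word π ≼ word σ → avoids σ π ≡ false
avoids-false⁺ σ π e = trans (sym (does-Avoids? σ π))
  (dec-false (σ Avoids? π) (λ h → h (≼⇒Contains {σ} {π} e)))

avoids-true⁻ : ∀ σ π → avoids σ π ≡ true → ¬ word π ≼ word σ
avoids-true⁻ σ π eq e with trans (sym eq) (avoids-false⁺ σ π e)
... | ()

avoids-false⁻ : ∀ σ π → avoids σ π ≡ false → word π ≼ word σ
-- The Boolean yields only a double negation; the search through all subsequences removes it.
avoids-false⁻ σ π eq = Contains⇒≼ {σ} {π} (decidable-stable (anySublist? (_≅? word π) (word σ)) ¬avoids)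
  where
  ¬avoids : ¬ σ Avoids π
  ¬avoids h with trans (sym eq) (avoids-true⁺ σ π (h ∘ ≼⇒Contains {σ} {π}))
  ... | ()

avoids-resp-≼ : ∀ σ {π π′} → word π ≼ word π′ → avoids σ π ≡ true → avoids σ π′ ≡ true
avoids-resp-≼ σ {π} {π′} π≼π′ h = avoids-true⁺ σ π′ (avoids-true⁻ σ π h ∘ ≼-trans π≼π′)

-- Avoidance of π in 213[σ₁,1,σ₂]

module _ (πs : List 𝔖) (σ₁ σ₂ : 𝔖) where

  avoids-lower avoids-upper : ℕ → Bool
  avoids-lower j = avoids σ₁ (lower πs (suc j))
  avoids-upper j = avoids σ₂ (upper πs (suc j))

  avoids-upper⁻ : ∀ j → avoids-upper j ≡ true → ¬ ⨁⋆ (drop j πs) ≼ word σ₂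
  avoids-upper⁻ j h e = avoids-true⁻ σ₂ (upper πs (suc j)) h (subst (_≼ word σ₂) (sym (word-ι⋆ (drop j πs))) e)

  avoids-upper⁺ : ∀ j → avoids-upper j ≡ false → ⨁⋆ (drop j πs) ≼ word σ₂
  avoids-upper⁺ j h = subst (_≼ word σ₂) (word-ι⋆ (drop j πs)) (avoids-false⁻ σ₂ (upper πs (suc j)) h)

  avoids-lower⁻ : ∀ {j} → j < length πs → avoids-lower j ≡ true → ¬ ⨁⋆ (take (suc j) πs) ≼ word σ₁ ⋆ʷ
  avoids-lower⁻ {j} j< h e = avoids-true⁻ σ₁ (lower πs (suc j)) h (lower-≼⁻ πs σ₁ j< e)

  avoids-lower⁺ : ∀ {j} → j < length πs → avoids-lower j ≡ false → ⨁⋆ (take (suc j) πs) ≼ word σ₁ ⋆ʷ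
  avoids-lower⁺ {j} j< h = lower-≼⁺ πs σ₁ j< (avoids-false⁻ σ₁ (lower πs (suc j)) h)

  -- The cut before all blocks gives the conjunct `b 0`, since the empty word occurs in σ₁⋆. An
  -- inner cut after j + 1 blocks gives a j ∨ b (j + 1). The cut after all s + 1 blocks gives `a s`,
  -- since nothing is left for σ₂.
  avoids-213 : ∀ π s → word π ≡ ⨁⋆ πs → length πs ≡ suc s →
               avoids 213[ σ₁ ,1, σ₂ ] π ≡ separated avoids-lower avoids-upper s ∧ avoids-lower s
  avoids-213 π s eqπ len = decided (separated avoids-lower avoids-upper s ∧ avoids-lower s)
    (λ h → avoids-true⁺ 213[ σ₁ ,1, σ₂ ] π λ e →
      excluded (separated∧-true⁻ avoids-lower avoids-upper s h)
        (⨁⋆-≼-213⁻ πs σ₁ σ₂ (subst (_≼ word 213[ σ₁ ,1, σ₂ ]) eqπ e)))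
    (λ h → avoids-false⁺ 213[ σ₁ ,1, σ₂ ] π (subst (_≼ word 213[ σ₁ ,1, σ₂ ]) (sym eqπ)
      (found (separated∧-false⁻ avoids-lower avoids-upper s h))))
    where
    decided : ∀ c {d} → (c ≡ true → d ≡ true) → (c ≡ false → d ≡ false) → d ≡ c
    decided true  t f = t refl
    decided false t f = f refl
    excluded : avoids-upper 0 ≡ true ×
               (∀ {j} → j < s → avoids-lower j ≡ false → avoids-upper (suc j) ≡ true) ×
               avoids-lower s ≡ true →
               ¬ (∃[ i ] i ≤ length πs × ⨁⋆ (take i πs) ≼ word σ₁ ⋆ʷ × ⨁⋆ (drop i πs) ≼ word σ₂)
    excluded (b0 , _ , _)    (zero  , _ , _ , e₂)   = avoids-upper⁻ 0 b0 e₂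
    excluded (_  , step , as) (suc j , j< , e₁ , e₂) =
      [ (λ j<s → avoids-upper⁻ (suc j) (step j<s (¬-not λ aj → avoids-lower⁻ j< aj e₁)) e₂)
      , (λ j≡s → avoids-lower⁻ j< (trans (cong avoids-lower j≡s) as) e₁)
      ]′ (m≤n⇒m<n∨m≡n (≤-pred (subst (suc j ≤_) len j<)))
    found : avoids-upper 0 ≡ false ⊎
            (∃[ j ] j < s × avoids-lower j ≡ false × avoids-upper (suc j) ≡ false) ⊎
            avoids-lower s ≡ false →
            ⨁⋆ πs ≼ word 213[ σ₁ ,1, σ₂ ]
    found (inj₁ b0) = ⨁⋆-≼-213⁺ πs σ₁ σ₂ 0 (⊆⇒≼ (minimum _)) (avoids-upper⁺ 0 b0)
    found (inj₂ (inj₁ (j , j<s , aj , bj))) = ⨁⋆-≼-213⁺ πs σ₁ σ₂ (suc j)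
      (avoids-lower⁺ (≤-trans (m<n⇒m<1+n j<s) (≤-reflexive (sym len))) aj) (avoids-upper⁺ (suc j) bj)
    found (inj₂ (inj₂ as)) = ⨁⋆-≼-213⁺ πs σ₁ σ₂ (suc s)
      (avoids-lower⁺ (≤-reflexive (sym len)) as)
      (subst (λ τs → ⨁⋆ τs ≼ word σ₂) (sym (drop-all (suc s) πs (≤-reflexive len))) (⊆⇒≼ (minimum _)))

  avoids-213-telescope : ∀ π s → word π ≡ ⨁⋆ πs → length πs ≡ suc s →
    χ (avoids 213[ σ₁ ,1, σ₂ ] π) ≡
    Σℤ (applyUpTo suc (suc s)) (λ i → χ (avoids σ₁ (lower πs i)) *ᶻ χ (avoids σ₂ (upper πs i))) -ᶻ
    Σℤ (applyUpTo suc s) (λ i → χ (avoids σ₁ (lower πs i)) *ᶻ χ (avoids σ₂ (upper πs (i + 1))))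
  avoids-213-telescope π s eqπ len = begin
    χ (avoids 213[ σ₁ ,1, σ₂ ] π)
      ≡⟨ cong χ (avoids-213 π s eqπ len) ⟩
    χ (separated avoids-lower avoids-upper s ∧ avoids-lower s)
      ≡⟨ isolate (χ (separated avoids-lower avoids-upper s ∧ avoids-lower s)) _ ⟩
    χ (separated avoids-lower avoids-upper s ∧ avoids-lower s) +ᶻ Σℤ (applyUpTo suc s) h -ᶻ
      Σℤ (applyUpTo suc s) h
      ≡⟨ cong (_-ᶻ Σℤ (applyUpTo suc s) h) (sym (telescope avoids-lower avoids-upper
           (λ j → avoids-resp-≼ σ₁ (lower-mono πs j)) (λ j → avoids-resp-≼ σ₂ (upper-anti πs j)) s)) ⟩
    Σℤ (applyUpTo suc (suc s)) g -ᶻ Σℤ (applyUpTo suc s) h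
      ≡⟨ cong₂ _-ᶻ_ (Σℤ-cong (applyUpTo suc (suc s)) g≡) (Σℤ-cong (applyUpTo suc s) h≡) ⟩
    _ ∎
    where
    open ≡-Reasoning
    g h : ℕ → ℤ
    g i = χ (avoids-lower (pred i) ∧ avoids-upper (pred i))
    h i = χ (avoids-lower (pred i) ∧ avoids-upper i)
    isolate : ∀ x y → x ≡ x +ᶻ y -ᶻ y
    isolate = solve-∀
    g≡ : ∀ {i n} → i ∈ applyUpTo suc n → g i ≡ χ (avoids σ₁ (lower πs i)) *ᶻ χ (avoids σ₂ (upper πs i))
    g≡ i∈ = case ∈-applyUpTo⁻ suc i∈ of λ where
      (j , _ , refl) → χ-∧ (avoids-lower j) (avoids-upper j)
    h≡ : ∀ {i n} → i ∈ applyUpTo suc n →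
         h i ≡ χ (avoids σ₁ (lower πs i)) *ᶻ χ (avoids σ₂ (upper πs (i + 1)))
    h≡ i∈ = case ∈-applyUpTo⁻ suc i∈ of λ where
      (j , _ , refl) → trans (χ-∧ (avoids-lower j) (avoids-upper (suc j)))
        (cong (λ i → χ (avoids-lower j) *ᶻ χ (avoids σ₂ (upper πs i))) (+-comm 1 (suc j)))

-- Enumeration of permutations and decomposition of 312-avoiders

word-injective : ∀ {σ τ} → word σ ≡ word τ → σ ≡ τ
word-injective {perm w _} {perm .w _} refl = refl

wordsOver-unique : ∀ {A} n → Unique A → Unique (wordsOver A n)
wordsOver-unique zero    u = [] ∷ []
wordsOver-unique (suc n) u = Uniqueₚ.cartesianProductWith⁺ _∷_ ∷-injective u (wordsOver-unique n u)

∈-wordsOver⁺ : ∀ {A} w → All (_∈ A) w → w ∈ wordsOver A (length w)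
∈-wordsOver⁺ []      []       = here refl
∈-wordsOver⁺ (x ∷ w) (x∈ ∷ h) = ∈-cartesianProductWith⁺ _∷_ x∈ (∈-wordsOver⁺ w h)

∈-wordsOver⁻ : ∀ {A w} n → w ∈ wordsOver A n → length w ≡ n
∈-wordsOver⁻ zero    (here refl) = refl
∈-wordsOver⁻ {A} (suc n) w∈ with ∈-cartesianProductWith⁻ _∷_ A (wordsOver A n) w∈
... | _ , _ , _ , v∈ , refl = cong suc (∈-wordsOver⁻ n v∈)

map-mapMaybe-dec : ∀ {A B : Set} {P : A → Set} (P? : Decidable P) (f : ∀ x → P x → B) (g : B → A) →
                   (∀ x p → g (f x p) ≡ x) → ∀ xs →
                   map g (mapMaybe (λ x → Maybe.map (f x) (dec⇒maybe (P? x))) xs) ≡ filter P? xs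
map-mapMaybe-dec P? f g gf []       = refl
map-mapMaybe-dec P? f g gf (x ∷ xs) with P? x
... | yes p = cong₂ _∷_ (gf x p) (map-mapMaybe-dec P? f g gf xs)
... | no  _ = map-mapMaybe-dec P? f g gf xs

-- Reading the words back replaces `mapMaybe` by a filter, so uniqueness and membership for
-- `permutations` reduce to those for plain words.
word-toPerm : ∀ ws → map word (mapMaybe toPerm ws) ≡ filter isPermutation? ws
word-toPerm = map-mapMaybe-dec isPermutation? (λ w p → perm w p) word (λ _ _ → refl)

[1⋯_]-unique : ∀ n → Unique [ 1 ⋯ n ]
[1⋯ n ]-unique = Uniqueₚ.applyUpTo⁺₁ suc n (λ i<j _ eq → <⇒≢ i<j (suc-injective eq))

permutations-unique : ∀ n → Unique (permutations n)
permutations-unique n = Uniqueₚ.map⁻ (subst Unique (sym (word-toPerm (wordsOver [ 1 ⋯ n ] n)))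
  (Uniqueₚ.filter⁺ isPermutation? (wordsOver-unique n [1⋯ n ]-unique)))

∈-permutations⁺ : ∀ σ → σ ∈ permutations ∣ σ ∣
∈-permutations⁺ σ with ∈-map⁻ word (subst (word σ ∈_) (sym (word-toPerm (wordsOver [ 1 ⋯ ∣ σ ∣ ] ∣ σ ∣)))
    (∈-filter⁺ isPermutation?
      (∈-wordsOver⁺ (word σ) (All.tabulate (∈-resp-↭ (isPermutation σ)))) (isPermutation σ)))
... | τ , τ∈ , eq = subst (_∈ permutations ∣ σ ∣) (word-injective (sym eq)) τ∈

∈-permutations⁻ : ∀ {σ} n → σ ∈ permutations n → ∣ σ ∣ ≡ n
∈-permutations⁻ n σ∈ = ∈-wordsOver⁻ n (proj₁ (∈-filter⁻ isPermutation?
  (subst (_ ∈_) (word-toPerm (wordsOver [ 1 ⋯ n ] n)) (∈-map⁺ word σ∈))))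

∈-𝔖⁺ : ∀ {σ} n Π → σ ∈𝔖 n ⟨ Π ⟩ → σ ∈ 𝔖[ n ]⟨ Π ⟩
∈-𝔖⁺ {σ} n Π (refl , h) = ∈-filter⁺ (λ σ → All.all? (σ Avoids?_) Π) (∈-permutations⁺ σ) h

∈-𝔖⁻ : ∀ {σ} n Π → σ ∈ 𝔖[ n ]⟨ Π ⟩ → σ ∈𝔖 n ⟨ Π ⟩
∈-𝔖⁻ n Π σ∈ = map₁ (∈-permutations⁻ n)
  (∈-filter⁻ (λ σ → All.all? (σ Avoids?_) Π) {xs = permutations n} σ∈)

𝔖-unique : ∀ n Π → Unique 𝔖[ n ]⟨ Π ⟩
𝔖-unique n Π = Uniqueₚ.filter⁺ (λ σ → All.all? (σ Avoids?_) Π) (permutations-unique n)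

-- Existence and uniqueness of the decomposition 213[σ₁,1,σ₂]

∣213∣ : ∀ σ₁ σ₂ → ∣ 213[ σ₁ ,1, σ₂ ] ∣ ≡ suc (∣ σ₁ ∣ + ∣ σ₂ ∣)
∣213∣ σ₁ σ₂ = begin
  ∣ 213[ σ₁ ,1, σ₂ ] ∣                        ≡⟨ cong length (word-213 σ₁ σ₂) ⟩
  length (word σ₁ ⋆ʷ ++ map _ (word σ₂))      ≡⟨ length-++ (word σ₁ ⋆ʷ) ⟩
  length (word σ₁ ⋆ʷ) + length (map _ (word σ₂)) ≡⟨ cong₂ _+_ (length-⋆ʷ (word σ₁)) (length-map _ (word σ₂)) ⟩
  ∣ σ₁ ∣ + 1 + ∣ σ₂ ∣                         ≡⟨ cong (_+ ∣ σ₂ ∣) (+-comm ∣ σ₁ ∣ 1) ⟩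
  suc (∣ σ₁ ∣ + ∣ σ₂ ∣)                       ∎
  where open ≡-Reasoning

split-unique : ∀ {A : Set} {z : A} as as′ {bs bs′} → z ∉ as → z ∉ as′ →
               as ++ z ∷ bs ≡ as′ ++ z ∷ bs′ → as ≡ as′ × bs ≡ bs′
split-unique []       []         _  _   refl = refl , refl
split-unique []       (a′ ∷ as′) _  z∉′ eq = ⊥-elim (z∉′ (here (∷-injectiveˡ eq)))
split-unique (a ∷ as) []         z∉ _   eq = ⊥-elim (z∉ (here (sym (∷-injectiveˡ eq))))
split-unique (a ∷ as) (a′ ∷ as′) z∉ z∉′ eq =
  map₁ (cong₂ _∷_ (∷-injectiveˡ eq)) (split-unique as as′ (z∉ ∘ there) (z∉′ ∘ there) (∷-injectiveʳ eq))

-- The letter 1 marks where the first part ends. Equality of the first parts makes the shifts of the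
-- second parts equal, so these can be cancelled.
213-injective : ∀ {σ₁ σ₂ τ₁ τ₂} → 213[ σ₁ ,1, σ₂ ] ≡ 213[ τ₁ ,1, τ₂ ] → σ₁ ≡ τ₁ × σ₂ ≡ τ₂
213-injective {σ₁} {σ₂} {τ₁} {τ₂} eq =
  σ₁≡τ₁ , word-injective (map-injective (+-cancelˡ-≡ _ _ _)
    (trans (proj₂ parts) (cong (λ σ → map (∣ σ ∣ + 1 +_) (word τ₂)) (sym σ₁≡τ₁))))
  where
  1∉ : ∀ σ → 1 ∉ map suc (word σ)
  1∉ σ 1∈ = <-irrefl refl (1≪ σ (here refl) 1∈)
  words : map suc (word σ₁) ++ 1 ∷ map (∣ σ₁ ∣ + 1 +_) (word σ₂) ≡
          map suc (word τ₁) ++ 1 ∷ map (∣ τ₁ ∣ + 1 +_) (word τ₂)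
  words = trans (sym (++-assoc (map suc (word σ₁)) (1 ∷ []) _))
    (trans (sym (word-213 σ₁ σ₂)) (trans (cong word eq)
      (trans (word-213 τ₁ τ₂) (++-assoc (map suc (word τ₁)) (1 ∷ []) _))))
  parts = split-unique (map suc (word σ₁)) (map suc (word τ₁)) (1∉ σ₁) (1∉ τ₁) words
  σ₁≡τ₁ : σ₁ ≡ τ₁
  σ₁≡τ₁ = word-injective (map-injective suc-injective (proj₁ parts))

≼-213ˡ : ∀ σ₁ σ₂ → word σ₁ ≼ word 213[ σ₁ ,1, σ₂ ]
≼-213ˡ σ₁ σ₂ = ≼-trans (⋆ʷ-increasing (word σ₁))
  (subst (word σ₁ ⋆ʷ ≼_) (sym (word-213 σ₁ σ₂)) (⊆⇒≼ (Sublistₚ.++⁺ʳ _ ⊆-refl)))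

≼-213ʳ : ∀ σ₁ σ₂ → word σ₂ ≼ word 213[ σ₁ ,1, σ₂ ]
≼-213ʳ σ₁ σ₂ = ≼-trans (≼-shift (∣ σ₁ ∣ + 1) (word σ₂))
  (subst (map (∣ σ₁ ∣ + 1 +_) (word σ₂) ≼_) (sym (word-213 σ₁ σ₂)) (⊆⇒≼ (Sublistₚ.++⁺ˡ (word σ₁ ⋆ʷ) ⊆-refl)))

-- 312 is ⊕-indecomposable and does not end with its smallest letter.
312-≼-213⁻ : ∀ σ₁ σ₂ → word p312 ≼ word 213[ σ₁ ,1, σ₂ ] →
             word p312 ≼ word σ₁ ⊎ word p312 ≼ word σ₂
312-≼-213⁻ σ₁ σ₂ e with ≼-213⁻ σ₁ σ₂ e
... | []                , _      , refl , _  , e₂ , _  = inj₂ e₂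
... | _ ∷ []            , _      , refl , _  , _  , lt with lt (here refl) (here refl)
...   | s≤s ()
312-≼-213⁻ σ₁ σ₂ e | _ ∷ _ ∷ [] , _ , refl , _ , _ , lt with lt (here refl) (here refl)
...   | s≤s (s≤s ())
312-≼-213⁻ σ₁ σ₂ e | _ ∷ _ ∷ _ ∷ [] , [] , refl , e₁ , _ , _ with ≼-⋆ʷ⁻ σ₁ e₁
...   | inj₁ e′ = inj₁ e′
...   | inj₂ (_ ∷ _ ∷ [] , _ , refl , _ , lt) with lt (here refl) (there (here refl))
...     | s≤s ()
312-≼-213⁻ σ₁ σ₂ e | _ ∷ _ ∷ _ ∷ [] , [] , refl , e₁ , _ , _ | inj₂ (_ ∷ _ ∷ _ ∷ []    , _ , () , _)
312-≼-213⁻ σ₁ σ₂ e | _ ∷ _ ∷ _ ∷ [] , [] , refl , e₁ , _ , _ | inj₂ (_ ∷ _ ∷ _ ∷ _ ∷ _ , _ , () , _)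

unique-⊆⇒length≤ : ∀ {xs ys : List ℕ} → Unique xs → (∀ {x} → x ∈ xs → x ∈ ys) → length xs ≤ length ys
unique-⊆⇒length≤ {[]}     []         sub = z≤n
unique-⊆⇒length≤ {x ∷ xs} (x∉ ∷ uxs) sub with ∈-∃++ (sub (here refl))
... | as , bs , refl = ≤-trans
  (s≤s (unique-⊆⇒length≤ uxs λ y∈ → remove (∈-++⁻ as (sub (there y∈))) (All.lookup x∉ y∈)))
  (≤-reflexive (trans (cong suc (length-++ as))
    (trans (sym (+-suc (length as) (length bs))) (sym (length-++ as)))))
  where
  remove : ∀ {y} → y ∈ as ⊎ y ∈ x ∷ bs → x ≢ y → y ∈ as ++ bs
  remove (inj₁ y∈)          x≢y = ∈-++⁺ˡ y∈
  remove (inj₂ (here refl)) x≢y = ⊥-elim (x≢y refl)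
  remove (inj₂ (there y∈))  x≢y = ∈-++⁺ʳ as y∈

unshift : ∀ c xs → (∀ {x} → x ∈ xs → c ≤ x) → ∃[ ys ] xs ≡ map (c +_) ys
unshift c []       h = [] , refl
unshift c (x ∷ xs) h with unshift c xs (h ∘ there)
... | ys , eq = x ∸ c ∷ ys , cong₂ _∷_ (sym (m+[n∸m]≡n (h (here refl)))) eq

1∈word : ∀ {n} σ → ∣ σ ∣ ≡ suc n → 1 ∈ word σ
1∈word σ len = ∈-resp-↭ (↭-sym (isPermutation σ)) (∈-applyUpTo⁺ suc (subst (0 <_) (sym len) (s≤s z≤n)))

-- Cut the word at its 1 into `a` and `b`. Avoidance of 312 puts `a` below `b`, and counting values
-- then leaves 2, ..., ∣a∣ + 1 for `a` and the larger values for `b`, so both become permutations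
-- after a shift.
213-decomposition : ∀ {n} σ → ∣ σ ∣ ≡ suc n → σ Avoids p312 →
                    ∃₂ λ σ₁ σ₂ → ∣ σ₁ ∣ + ∣ σ₂ ∣ ≡ n × σ ≡ 213[ σ₁ ,1, σ₂ ]
213-decomposition {n} σ len avoids312 with ∈-∃++ (1∈word σ len)
... | a , b , eq =
  go (unshift 1 a (λ x∈ → proj₁ (bounded σ (a⊆ x∈)))) (unshift (length a + 1) b (λ y∈ → <⇒≤ (b-large y∈)))
  where
  unique : Unique (a ++ 1 ∷ b)
  unique = subst Unique eq (perm⇒distinct (isPermutation σ))
  a⊆ : ∀ {x} → x ∈ a → x ∈ word σ
  a⊆ x∈ = subst (_ ∈_) (sym eq) (∈-++⁺ˡ x∈)
  b⊆ : ∀ {y} → y ∈ b → y ∈ word σ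
  b⊆ y∈ = subst (_ ∈_) (sym eq) (∈-++⁺ʳ a (there y∈))
  cross = proj₂ (proj₂ (AllPairs-++⁻ a unique))
  ua = proj₁ (AllPairs-++⁻ a unique)
  u1b = proj₁ (proj₂ (AllPairs-++⁻ a unique))
  ub : Unique b
  ub with u1b
  ... | _ ∷ ub = ub
  1<a : ∀ {x} → x ∈ a → 1 < x
  1<a x∈ = ≤∧≢⇒< (proj₁ (bounded σ (a⊆ x∈))) (≢-sym (cross x∈ (here refl)))
  1<b : ∀ {y} → y ∈ b → 1 < y
  1<b y∈ with u1b
  ... | 1∉ ∷ _ = ≤∧≢⇒< (proj₁ (bounded σ (b⊆ y∈))) (All.lookup 1∉ y∈)
  a≪b : a ≪ b
  a≪b {x} {y} x∈ y∈ with <-cmp x y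
  ... | tri< x<y _ _ = x<y
  ... | tri≈ _ x≡y _ = ⊥-elim (cross x∈ (there y∈) x≡y)
  -- Otherwise x, 1, y is an occurrence of 312.
  ... | tri> _ _ y<x = ⊥-elim (avoids312 (≼⇒Contains {σ} {p312}
    ((x , 3) ∷ (1 , 1) ∷ (y , 2) ∷ [] ,
     subst (_ ⊆_) (sym eq) (Sublistₚ.++⁺ (from∈ x∈) (refl ∷ from∈ y∈)) , refl ,
     ((>-sameOrder (1<a x∈) (s≤s (s≤s z≤n))) ∷ (>-sameOrder y<x (s≤s (s≤s (s≤s z≤n)))) ∷ []) ∷
     ((<-sameOrder (1<b y∈) (s≤s (s≤s z≤n))) ∷ []) ∷ [] ∷ [])))
  -- As b lies above a, the values 2, …, x + 1 all occur in a.
  a-small : ∀ {x} → suc x ∈ a → x ≤ length a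
  a-small {x} x∈ = subst (_≤ length a) (length-applyUpTo (2 +_) x)
    (unique-⊆⇒length≤ (Uniqueₚ.applyUpTo⁺₁ (2 +_) x (λ i<j _ e → <⇒≢ i<j (suc-injective (suc-injective e)))) in-a)
    where
    in-a : ∀ {v} → v ∈ applyUpTo (2 +_) x → v ∈ a
    in-a v∈ with ∈-applyUpTo⁻ (2 +_) v∈
    ... | i , i<x , refl with ∈-++⁻ a (subst (_ ∈_) eq (∈-resp-↭ (↭-sym (isPermutation σ))
                              (∈-applyUpTo⁺ suc (≤-trans (s≤s i<x) (proj₂ (bounded σ (a⊆ x∈)))))))
    ...   | inj₁ v∈a         = v∈a
    ...   | inj₂ (there v∈b) = ⊥-elim (<⇒≱ (a≪b x∈ v∈b) (s≤s i<x))
  -- The counterpart: 1 and the letters of `a` are ∣a∣ + 1 distinct positive values below y.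
  b-large : ∀ {y} → y ∈ b → length a + 1 < y
  b-large {zero} y∈ with 1<b y∈
  ... | ()
  b-large {suc y} y∈ = s≤s (subst (_≤ y) (+-comm 1 (length a))
    (subst (suc (length a) ≤_) (length-applyUpTo suc y)
    (unique-⊆⇒length≤ (All.tabulate (λ x∈ → <⇒≢ (1<a x∈)) ∷ ua) below)))
    where
    below : ∀ {v} → v ∈ 1 ∷ a → v ∈ applyUpTo suc y
    below (here refl) = ∈-applyUpTo⁺ suc (≤-pred (1<b y∈))
    below {zero}  (there v∈) with 1<a v∈
    ... | ()
    below {suc v} (there v∈) = ∈-applyUpTo⁺ suc (≤-pred (a≪b v∈ y∈))
  lengths : length a + length b ≡ n
  lengths = suc-injective (trans (sym (+-suc (length a) (length b)))
    (trans (sym (length-++ a)) (trans (cong length (sym eq)) len)))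
  go : ∃[ a′ ] a ≡ map suc a′ → ∃[ b′ ] b ≡ map (length a + 1 +_) b′ →
       ∃₂ λ σ₁ σ₂ → ∣ σ₁ ∣ + ∣ σ₂ ∣ ≡ n × σ ≡ 213[ σ₁ ,1, σ₂ ]
  go (a′ , a≡) (b′ , b≡) = σ₁ , σ₂ , trans (cong₂ _+_ (sym la) (sym lb)) lengths ,
    word-injective (trans eq (sym (trans (word-213 σ₁ σ₂) (trans (++-assoc (map suc a′) (1 ∷ []) _)
      (cong₂ (λ u v → u ++ 1 ∷ v) (sym a≡) (trans (cong (λ l → map (l + 1 +_) b′) (sym la)) (sym b≡)))))))
    where
    la : length a ≡ length a′
    la = trans (cong length a≡) (length-map suc a′)
    lb : length b ≡ length b′
    lb = trans (cong length b≡) (length-map _ b′)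
    bound-a : ∀ {x} → x ∈ a′ → 1 ≤ x × x ≤ length a′
    bound-a {x} x∈ = ≤-pred (1<a sx∈) , subst (x ≤_) la (a-small sx∈)
      where
      sx∈ : suc x ∈ a
      sx∈ = subst (_ ∈_) (sym a≡) (∈-map⁺ suc x∈)
    bound-b : ∀ {y} → y ∈ b′ → 1 ≤ y × y ≤ length b′
    bound-b {y} y∈ =
      +-cancelˡ-≤ (length a + 1) 1 y (subst (_≤ length a + 1 + y) (+-comm 1 (length a + 1)) (b-large y∈b)) ,
      subst (y ≤_) lb (+-cancelˡ-≤ (length a + 1) y (length b) (≤-trans (proj₂ (bounded σ (b⊆ y∈b)))
        (≤-reflexive (trans (trans len (cong suc (sym lengths))) (cong (_+ length b) (+-comm 1 (length a)))))))
      where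
      y∈b : length a + 1 + y ∈ b
      y∈b = subst (_ ∈_) (sym b≡) (∈-map⁺ _ y∈)
    σ₁ σ₂ : 𝔖
    σ₁ = perm a′ (distinct-bounded⇒perm (Uniqueₚ.map⁻ (subst Unique a≡ ua)) (All.tabulate bound-a))
    σ₂ = perm b′ (distinct-bounded⇒perm (Uniqueₚ.map⁻ (subst Unique b≡ ub)) (All.tabulate bound-b))

-- The recurrence

avoids-213-sum : ∀ πs σ₁ σ₂ π → word π ≡ ⨁⋆ πs →
  χ (avoids 213[ σ₁ ,1, σ₂ ] π) ≡
  Σℤ [ 1 ⋯ length πs ] (λ i → χ (avoids σ₁ (lower πs i)) *ᶻ χ (avoids σ₂ (upper πs i))) -ᶻ
  Σℤ [ 1 ⋯ length πs ∸ 1 ] (λ i → χ (avoids σ₁ (lower πs i)) *ᶻ χ (avoids σ₂ (upper πs (i + 1))))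
-- For r = 0 the truncated r ∸ 1 is 0 too, so both sums are empty; the left side is 0 because the
-- empty permutation occurs everywhere.
avoids-213-sum []       σ₁ σ₂ π eq =
  cong χ (avoids-false⁺ 213[ σ₁ ,1, σ₂ ] π (subst (_≼ word 213[ σ₁ ,1, σ₂ ]) (sym eq) (⊆⇒≼ (minimum _))))
avoids-213-sum (π₁ ∷ πs) σ₁ σ₂ π eq = avoids-213-telescope (π₁ ∷ πs) σ₁ σ₂ π (length πs) eq refl

312-avoiders : ℕ → List 𝔖
312-avoiders n = 𝔖[ n ]⟨ p312 ∷ [] ⟩

213-products : ℕ → ℕ → List 𝔖
213-products n k = cartesianProductWith 213[_,1,_] (312-avoiders k) (312-avoiders (n ∸ k))

∈-213-products⁻ : ∀ n k {σ} → σ ∈ 213-products n k →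
                  ∃₂ λ σ₁ σ₂ → σ₁ ∈ 312-avoiders k × σ₂ ∈ 312-avoiders (n ∸ k) × σ ≡ 213[ σ₁ ,1, σ₂ ]
∈-213-products⁻ n k = ∈-cartesianProductWith⁻ 213[_,1,_] (312-avoiders k) (312-avoiders (n ∸ k))

-- Within one `k` this is injectivity of 213[σ₁,1,σ₂]; different `k` cannot meet, since `k` is
-- recovered as the size of σ₁.
213-products-unique : ∀ n → Unique (concat (map (213-products n) [ 0 ⋯ n ]))
213-products-unique n = Uniqueₚ.concat⁺
  (Allₚ.map⁺ {xs = [ 0 ⋯ n ]} {f = 213-products n} (All.tabulate λ {k} _ →
    Uniqueₚ.cartesianProductWith⁺ 213[_,1,_] 213-injective (𝔖-unique k (p312 ∷ [])) (𝔖-unique (n ∸ k) (p312 ∷ []))))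
  (AllPairsₚ.map⁺ {f = 213-products n} {xs = [ 0 ⋯ n ]} (AllPairsₚ.applyUpTo⁺₁ (λ k → k) (suc n)
    λ {i} {j} i<j _ → disjoint {i} {j} (<⇒≢ i<j)))
  where
  disjoint : ∀ {i j} → i ≢ j → Disjoint (213-products n i) (213-products n j)
  disjoint {i} {j} i≢j (σ∈i , σ∈j) = case (∈-213-products⁻ n i σ∈i ,′ ∈-213-products⁻ n j σ∈j) of λ where
    ((σ₁ , σ₂ , σ₁∈ , _ , eq) , (τ₁ , τ₂ , τ₁∈ , _ , eq′)) →
      i≢j (trans (sym (proj₁ (∈-𝔖⁻ i (p312 ∷ []) σ₁∈)))
        (trans (cong ∣_∣ (proj₁ (213-injective {σ₁} {σ₂} {τ₁} {τ₂} (trans (sym eq) eq′))))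
               (proj₁ (∈-𝔖⁻ j (p312 ∷ []) τ₁∈))))

avoids312-resp-≼ : ∀ {σ τ} → word σ ≼ word τ → τ Avoids p312 → σ Avoids p312
avoids312-resp-≼ {σ} {τ} e h c = h (≼⇒Contains {τ} {p312} (≼-trans (Contains⇒≼ {σ} {p312} c) e))

avoids312-213 : ∀ {σ₁ σ₂} → σ₁ Avoids p312 → σ₂ Avoids p312 → 213[ σ₁ ,1, σ₂ ] Avoids p312
avoids312-213 {σ₁} {σ₂} h₁ h₂ c =
  [ h₁ ∘ ≼⇒Contains {σ₁} {p312} , h₂ ∘ ≼⇒Contains {σ₂} {p312} ]′
  (312-≼-213⁻ σ₁ σ₂ (Contains⇒≼ {213[ σ₁ ,1, σ₂ ]} {p312} c))

-- Neither list has duplicates, so equal membership suffices. One inclusion is the decomposition at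
-- the 1, the other that 312 cannot straddle the two parts.
312-avoiders-↭ : ∀ n → 312-avoiders (suc n) ↭ concat (map (213-products n) [ 0 ⋯ n ])
312-avoiders-↭ n = ∼bag⇒↭
  (unique∧set⇒bag (𝔖-unique (suc n) (p312 ∷ [])) (213-products-unique n) (mk⇔ to from))
  where
  to : ∀ {σ} → σ ∈ 312-avoiders (suc n) → σ ∈ concat (map (213-products n) [ 0 ⋯ n ])
  to {σ} σ∈ = case ∈-𝔖⁻ (suc n) (p312 ∷ []) σ∈ of λ where
    (len , h ∷ []) → case 213-decomposition σ len h of λ where
      (σ₁ , σ₂ , refl , refl) → ∈-concat⁺′
        (∈-cartesianProductWith⁺ 213[_,1,_]
          (∈-𝔖⁺ {σ₁} ∣ σ₁ ∣ (p312 ∷ []) (refl , avoids312-resp-≼ {σ₁} {σ} (≼-213ˡ σ₁ σ₂) h ∷ []))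
          (∈-𝔖⁺ {σ₂} (∣ σ₁ ∣ + ∣ σ₂ ∣ ∸ ∣ σ₁ ∣) (p312 ∷ [])
            (sym (m+n∸m≡n ∣ σ₁ ∣ ∣ σ₂ ∣) , avoids312-resp-≼ {σ₂} {σ} (≼-213ʳ σ₁ σ₂) h ∷ [])))
        (∈-map⁺ (213-products n) (∈-applyUpTo⁺ (λ k → k) (s≤s (m≤m+n ∣ σ₁ ∣ ∣ σ₂ ∣))))
  from : ∀ {σ} → σ ∈ concat (map (213-products n) [ 0 ⋯ n ]) → σ ∈ 312-avoiders (suc n)
  from σ∈ = case ∈-concat⁻′ (map (213-products n) [ 0 ⋯ n ]) σ∈ of λ where
    (_ , σ∈k , k∈) → case ∈-map⁻ (213-products n) k∈ of λ where
      (k , k∈ , refl) → case (∈-213-products⁻ n k σ∈k ,′ ∈-applyUpTo⁻ (λ k → k) k∈) of λ where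
        ((σ₁ , σ₂ , σ₁∈ , σ₂∈ , refl) , (_ , k<1+n , refl)) →
          case (∈-𝔖⁻ k (p312 ∷ []) σ₁∈ ,′ ∈-𝔖⁻ (n ∸ k) (p312 ∷ []) σ₂∈) of λ where
            ((len₁ , h₁ ∷ []) , (len₂ , h₂ ∷ [])) → ∈-𝔖⁺ {213[ σ₁ ,1, σ₂ ]} (suc n) (p312 ∷ [])
              ( trans (∣213∣ σ₁ σ₂) (cong suc (trans (cong₂ _+_ len₁ len₂) (m+[n∸m]≡n (≤-pred k<1+n))))
              , avoids312-213 {σ₁} {σ₂} h₁ h₂ ∷ [])

-- Moving π from the index set into the weight lets sums for different patterns run over the same
-- 312-avoiders and be compared term by term.
Σℤ-𝔖 : ∀ n π g → Σℤ 𝔖[ n ]⟨ p312 ∷ π ∷ [] ⟩ g ≡ Σℤ (312-avoiders n) (λ σ → χ (avoids σ π) *ᶻ g σ)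
Σℤ-𝔖 n π g = begin
  Σℤ 𝔖[ n ]⟨ p312 ∷ π ∷ [] ⟩ g
    ≡⟨ Σℤ-filter (λ σ → All.all? (σ Avoids?_) (p312 ∷ π ∷ [])) (permutations n) g ⟩
  Σℤ (permutations n) (λ σ → χ (does (σ Avoids? p312) ∧ (does (σ Avoids? π) ∧ true)) *ᶻ g σ)
    ≡⟨ Σℤ-cong (permutations n) (λ {σ} _ →
         factor (does (σ Avoids? p312)) (g σ) (does-Avoids? σ π)) ⟩
  Σℤ (permutations n) (λ σ → χ (does (σ Avoids? p312) ∧ true) *ᶻ (χ (avoids σ π) *ᶻ g σ))
    ≡⟨ sym (Σℤ-filter (λ σ → All.all? (σ Avoids?_) (p312 ∷ [])) (permutations n)
         (λ σ → χ (avoids σ π) *ᶻ g σ)) ⟩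
  Σℤ (312-avoiders n) (λ σ → χ (avoids σ π) *ᶻ g σ) ∎
  where
  open ≡-Reasoning
  -- The trailing `true` is the value of `all?` on the empty rest of the pattern list.
  factor : ∀ a {b b′} c → b ≡ b′ → χ (a ∧ (b ∧ true)) *ᶻ c ≡ χ (a ∧ true) *ᶻ (χ b′ *ᶻ c)
  factor a {b} c refl rewrite ∧-identityʳ b | ∧-identityʳ a =
    trans (cong (_*ᶻ c) (χ-∧ a b)) (ℤ.*-assoc (χ a) (χ b) c)

Σℤ-213 : ∀ n g → Σℤ (312-avoiders (suc n)) g ≡
         Σℤ [ 0 ⋯ n ] (λ k → Σℤ (312-avoiders k) λ σ₁ → Σℤ (312-avoiders (n ∸ k)) λ σ₂ → g 213[ σ₁ ,1, σ₂ ])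
Σℤ-213 n g = begin
  Σℤ (312-avoiders (suc n)) g
    ≡⟨ Σℤ-↭ g (312-avoiders-↭ n) ⟩
  Σℤ (concat (map (213-products n) [ 0 ⋯ n ])) g
    ≡⟨ Σℤ-concat (map (213-products n) [ 0 ⋯ n ]) g ⟩
  Σℤ (map (213-products n) [ 0 ⋯ n ]) (λ σs → Σℤ σs g)
    ≡⟨ Σℤ-map (213-products n) [ 0 ⋯ n ] (λ σs → Σℤ σs g) ⟩
  Σℤ [ 0 ⋯ n ] (λ k → Σℤ (213-products n k) g)
    ≡⟨ Σℤ-cong [ 0 ⋯ n ] (λ {k} _ →
         Σℤ-cartesianProductWith 213[_,1,_] (312-avoiders k) (312-avoiders (n ∸ k)) g) ⟩
  _ ∎
  where open ≡-Reasoning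

-- Sums over pairs of 312-avoiders

module _ {A B : Set} (xs : List A) (ys : List B) where

  Σℤ-interchange : ∀ {C : Set} (is : List C) (w : C → A → B → ℤ) (T : A → B → ℤ) →
    Σℤ is (λ i → Σℤ xs λ x → Σℤ ys λ y → w i x y *ᶻ T x y) ≡
    Σℤ xs (λ x → Σℤ ys λ y → Σℤ is (λ i → w i x y) *ᶻ T x y)
  Σℤ-interchange is w T = trans (Σℤ-swap is xs (λ i x → Σℤ ys λ y → w i x y *ᶻ T x y))
    (Σℤ-cong xs λ {x} _ → trans (Σℤ-swap is ys (λ i y → w i x y *ᶻ T x y))
      (Σℤ-cong ys λ {y} _ → Σℤ-*ʳ is (λ i → w i x y) (T x y)))

  Σℤ-difference : ∀ (P Q T : A → B → ℤ) →
    Σℤ xs (λ x → Σℤ ys λ y → P x y *ᶻ T x y) -ᶻ Σℤ xs (λ x → Σℤ ys λ y → Q x y *ᶻ T x y) ≡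
    Σℤ xs (λ x → Σℤ ys λ y → (P x y -ᶻ Q x y) *ᶻ T x y)
  Σℤ-difference P Q T = sym (trans
    (Σℤ-cong xs λ {x} _ → trans (Σℤ-cong ys λ {y} _ → lemma (P x y) (Q x y) (T x y))
      (Σℤ-- ys (λ y → P x y *ᶻ T x y) (λ y → Q x y *ᶻ T x y)))
    (Σℤ-- xs (λ x → Σℤ ys λ y → P x y *ᶻ T x y) (λ x → Σℤ ys λ y → Q x y *ᶻ T x y)))
    where
    lemma : ∀ p q t → (p -ᶻ q) *ᶻ t ≡ p *ᶻ t -ᶻ q *ᶻ t
    lemma = solve-∀

module _ (st : 𝔖 → ℕ) {φ : Poly → ℤ} (φ-linear : Linear φ) where

  F-linear : ∀ n π → φ (F st n (p312 ∷ π ∷ [])) ≡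
                     Σℤ (312-avoiders n) (λ σ → χ (avoids σ π) *ᶻ φ (q^ st σ))
  F-linear n π = trans (respects-∑ φ-linear 𝔖[ n ]⟨ p312 ∷ π ∷ [] ⟩ (λ σ → q^ st σ))
                       (Σℤ-𝔖 n π (λ σ → φ (q^ st σ)))

module _ (st : 𝔖 → ℕ) {φ : Poly → ℤ} (φ-linear : Linear φ) where

  F-*ₚ-linear : ∀ k l π ρ → φ (F st k (p312 ∷ π ∷ []) *ₚ F st l (p312 ∷ ρ ∷ [])) ≡
    Σℤ (312-avoiders k) (λ σ → Σℤ (312-avoiders l) λ τ →
      χ (avoids σ π) *ᶻ χ (avoids τ ρ) *ᶻ φ (q^ (st σ + st τ)))
  F-*ₚ-linear k l π ρ = begin
    φ (F st k (p312 ∷ π ∷ []) *ₚ G)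
      ≡⟨ ∑-*ₚ φ-linear 𝔖[ k ]⟨ p312 ∷ π ∷ [] ⟩ (λ σ → q^ st σ) G ⟩
    Σℤ 𝔖[ k ]⟨ p312 ∷ π ∷ [] ⟩ (λ σ → φ (q^ st σ *ₚ G))
      ≡⟨ Σℤ-𝔖 k π (λ σ → φ (q^ st σ *ₚ G)) ⟩
    Σℤ (312-avoiders k) (λ σ → χ (avoids σ π) *ᶻ φ (q^ st σ *ₚ G))
      ≡⟨ Σℤ-cong (312-avoiders k) (λ {σ} _ → inner σ) ⟩
    _ ∎
    where
    open ≡-Reasoning
    G = F st l (p312 ∷ ρ ∷ [])
    inner : ∀ σ → χ (avoids σ π) *ᶻ φ (q^ st σ *ₚ G) ≡
            Σℤ (312-avoiders l) (λ τ → χ (avoids σ π) *ᶻ χ (avoids τ ρ) *ᶻ φ (q^ (st σ + st τ)))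
    inner σ = begin
      χ (avoids σ π) *ᶻ φ (q^ st σ *ₚ G)
        -- The second factor is expanded under φ composed with multiplication by `q^ st σ`, which is
        -- where the generality in φ is used.
        ≡⟨ cong (χ (avoids σ π) *ᶻ_) (F-linear st (*ₚ-linearʳ φ-linear (q^ st σ)) l ρ) ⟩
      χ (avoids σ π) *ᶻ Σℤ (312-avoiders l) (λ τ → χ (avoids τ ρ) *ᶻ φ (q^ st σ *ₚ q^ st τ))
        ≡⟨ sym (Σℤ-*ˡ (312-avoiders l) (χ (avoids σ π)) _) ⟩
      Σℤ (312-avoiders l) (λ τ → χ (avoids σ π) *ᶻ (χ (avoids τ ρ) *ᶻ φ (q^ st σ *ₚ q^ st τ)))
        ≡⟨ Σℤ-cong (312-avoiders l) (λ {τ} _ →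
             trans (cong (λ z → χ (avoids σ π) *ᶻ (χ (avoids τ ρ) *ᶻ z))
                         (respects-≈ φ-linear (q^-*ₚ (st σ) (st τ))))
                   (sym (ℤ.*-assoc (χ (avoids σ π)) (χ (avoids τ ρ)) _))) ⟩
      _ ∎

  F-*ₚ-sum-linear : ∀ k l (is : List ℕ) (ρ ρ′ : ℕ → 𝔖) →
    φ (∑[ i ∈ is ] F st k (p312 ∷ ρ i ∷ []) *ₚ F st l (p312 ∷ ρ′ i ∷ [])) ≡
    Σℤ (312-avoiders k) (λ σ → Σℤ (312-avoiders l) λ τ →
      Σℤ is (λ i → χ (avoids σ (ρ i)) *ᶻ χ (avoids τ (ρ′ i))) *ᶻ φ (q^ (st σ + st τ)))
  F-*ₚ-sum-linear k l is ρ ρ′ = trans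
    (respects-∑ φ-linear is (λ i → F st k (p312 ∷ ρ i ∷ []) *ₚ F st l (p312 ∷ ρ′ i ∷ [])))
    (trans (Σℤ-cong is λ {i} _ → F-*ₚ-linear k l (ρ i) (ρ′ i))
      (Σℤ-interchange (312-avoiders k) (312-avoiders l) is
        (λ i σ τ → χ (avoids σ (ρ i)) *ᶻ χ (avoids τ (ρ′ i))) (λ σ τ → φ (q^ (st σ + st τ)))))

  -- Once both sums are expanded, the pair (σ , τ) carries the alternating sum of indicators from
  -- `avoids-213-sum`, which collapses to a single indicator.
  bracket-linear : ∀ k l π πs → word π ≡ ⨁⋆ πs →
    φ ((∑[ i ∈ [ 1 ⋯ length πs ] ]
          F st k (p312 ∷ lower πs i ∷ []) *ₚ F st l (p312 ∷ upper πs i ∷ []))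
       -ₚ
       (∑[ i ∈ [ 1 ⋯ length πs ∸ 1 ] ]
          F st k (p312 ∷ lower πs i ∷ []) *ₚ F st l (p312 ∷ upper πs (i + 1) ∷ []))) ≡
    Σℤ (312-avoiders k) (λ σ → Σℤ (312-avoiders l) λ τ →
      χ (avoids 213[ σ ,1, τ ] π) *ᶻ φ (q^ (st σ + st τ)))
  bracket-linear k l π πs eq = trans (respects-- φ-linear
      (∑[ i ∈ [ 1 ⋯ length πs ] ] F st k (p312 ∷ lower πs i ∷ []) *ₚ F st l (p312 ∷ upper πs i ∷ []))
      (∑[ i ∈ [ 1 ⋯ length πs ∸ 1 ] ] F st k (p312 ∷ lower πs i ∷ []) *ₚ F st l (p312 ∷ upper πs (i + 1) ∷ [])))
    (trans (cong₂ _-ᶻ_ (F-*ₚ-sum-linear k l [ 1 ⋯ length πs ] (lower πs) (upper πs))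
                       (F-*ₚ-sum-linear k l [ 1 ⋯ length πs ∸ 1 ] (lower πs) (λ i → upper πs (i + 1))))
      (trans (Σℤ-difference (312-avoiders k) (312-avoiders l)
               (λ σ τ → Σℤ [ 1 ⋯ length πs ] λ i →
                 χ (avoids σ (lower πs i)) *ᶻ χ (avoids τ (upper πs i)))
               (λ σ τ → Σℤ [ 1 ⋯ length πs ∸ 1 ] λ i →
                 χ (avoids σ (lower πs i)) *ᶻ χ (avoids τ (upper πs (i + 1))))
               (λ σ τ → φ (q^ (st σ + st τ))))
        (Σℤ-cong (312-avoiders k) λ {σ} _ → Σℤ-cong (312-avoiders l) λ {τ} _ →
          cong (_*ᶻ φ (q^ (st σ + st τ))) (sym (avoids-213-sum πs σ τ π eq)))))

module _ (st : 𝔖 → ℕ) (f : ℕ → ℕ → ℕ)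
  (st-213 : ∀ n k → k ≤ n → (σ₁ σ₂ : 𝔖) →
    σ₁ ∈𝔖 k ⟨ p312 ∷ [] ⟩ → σ₂ ∈𝔖 (n ∸ k) ⟨ p312 ∷ [] ⟩ →
    st 213[ σ₁ ,1, σ₂ ] ≡ f k (n ∸ k) + st σ₁ + st σ₂) where

  recurrence : ∀ π πs → word π ≡ ⨁⋆ πs → ∀ n →
    F st (suc n) (p312 ∷ π ∷ []) ≈
    ∑[ k ∈ [ 0 ⋯ n ] ]
      q^ (f k (n ∸ k)) *ₚ
        ((∑[ i ∈ [ 1 ⋯ length πs ] ]
            F st k (p312 ∷ lower πs i ∷ []) *ₚ F st (n ∸ k) (p312 ∷ upper πs i ∷ []))
         -ₚ
         (∑[ i ∈ [ 1 ⋯ length πs ∸ 1 ] ]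
            F st k (p312 ∷ lower πs i ∷ []) *ₚ F st (n ∸ k) (p312 ∷ upper πs (i + 1) ∷ [])))
  recurrence π πs eq n m = begin
    coeff (F st (suc n) (p312 ∷ π ∷ [])) m
      ≡⟨ F-linear st (coeff-linear m) (suc n) π ⟩
    Σℤ (312-avoiders (suc n)) (λ σ → χ (avoids σ π) *ᶻ coeff (q^ st σ) m)
      ≡⟨ Σℤ-213 n (λ σ → χ (avoids σ π) *ᶻ coeff (q^ st σ) m) ⟩
    Σℤ [ 0 ⋯ n ] (λ k → Σℤ (312-avoiders k) λ σ₁ → Σℤ (312-avoiders (n ∸ k)) λ σ₂ →
      χ (avoids 213[ σ₁ ,1, σ₂ ] π) *ᶻ coeff (q^ st 213[ σ₁ ,1, σ₂ ]) m)
      -- The memberships are passed along because `st-213` speaks only of 312-avoiders of sizes k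
      -- and n ∸ k.
      ≡⟨ Σℤ-cong [ 0 ⋯ n ] (λ {k} k∈ → Σℤ-cong (312-avoiders k) λ {σ₁} σ₁∈ →
           Σℤ-cong (312-avoiders (n ∸ k)) λ {σ₂} σ₂∈ →
           cong (χ (avoids 213[ σ₁ ,1, σ₂ ] π) *ᶻ_) (monomial k σ₁ σ₂ (≤n k∈) σ₁∈ σ₂∈)) ⟩
    Σℤ [ 0 ⋯ n ] (λ k → Σℤ (312-avoiders k) λ σ₁ → Σℤ (312-avoiders (n ∸ k)) λ σ₂ →
      χ (avoids 213[ σ₁ ,1, σ₂ ] π) *ᶻ coeff (q^ f k (n ∸ k) *ₚ q^ (st σ₁ + st σ₂)) m)
      -- The factor `q^ f k (n ∸ k)` is absorbed into the functional, so the bracket is treated as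
      -- if it stood alone.
      ≡⟨ Σℤ-cong [ 0 ⋯ n ] (λ {k} _ → sym (bracket-linear st
           (*ₚ-linearʳ (coeff-linear m) (q^ f k (n ∸ k))) k (n ∸ k) π πs eq)) ⟩
    Σℤ [ 0 ⋯ n ] (λ k → coeff (q^ f k (n ∸ k) *ₚ bracket k) m)
      ≡⟨ sym (respects-∑ (coeff-linear m) [ 0 ⋯ n ] (λ k → q^ f k (n ∸ k) *ₚ bracket k)) ⟩
    coeff (∑[ k ∈ [ 0 ⋯ n ] ] q^ f k (n ∸ k) *ₚ bracket k) m ∎
    where
    open ≡-Reasoning
    bracket : ℕ → Poly
    bracket k =
      (∑[ i ∈ [ 1 ⋯ length πs ] ]
         F st k (p312 ∷ lower πs i ∷ []) *ₚ F st (n ∸ k) (p312 ∷ upper πs i ∷ []))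
      -ₚ
      (∑[ i ∈ [ 1 ⋯ length πs ∸ 1 ] ]
         F st k (p312 ∷ lower πs i ∷ []) *ₚ F st (n ∸ k) (p312 ∷ upper πs (i + 1) ∷ []))
    ≤n : ∀ {k} → k ∈ [ 0 ⋯ n ] → k ≤ n
    ≤n k∈ = case ∈-applyUpTo⁻ (λ k → k) k∈ of λ { (_ , k<1+n , refl) → ≤-pred k<1+n }
    monomial : ∀ k σ₁ σ₂ → k ≤ n → σ₁ ∈ 312-avoiders k → σ₂ ∈ 312-avoiders (n ∸ k) →
               coeff (q^ st 213[ σ₁ ,1, σ₂ ]) m ≡ coeff (q^ f k (n ∸ k) *ₚ q^ (st σ₁ + st σ₂)) m
    monomial k σ₁ σ₂ k≤n σ₁∈ σ₂∈ = trans
      (cong (λ e → coeff (q^ e) m)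
        (trans (st-213 n k k≤n σ₁ σ₂ (∈-𝔖⁻ k (p312 ∷ []) σ₁∈) (∈-𝔖⁻ (n ∸ k) (p312 ∷ []) σ₂∈))
               (+-assoc (f k (n ∸ k)) (st σ₁) (st σ₂))))
      (sym (q^-*ₚ (f k (n ∸ k)) (st σ₁ + st σ₂) m))

-- The initial values

F-0 : ∀ st π m → coeff (F st 0 (p312 ∷ π ∷ [])) m ≡ χ (avoids ε π) *ᶻ coeff (q^ st ε) m
-- The list of 312-avoiders of size 0 evaluates to ε alone, so the sum is one term plus 0.
F-0 st π m = trans (F-linear st (coeff-linear m) 0 π) (ℤ.+-identityʳ _)

F-0-ε : ∀ st π → π ≡ ε → F st 0 (p312 ∷ π ∷ []) ≈ 0ₚ
F-0-ε st π refl m = trans (F-0 st ε m)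
  (trans (cong (λ b → χ b *ᶻ coeff (q^ st ε) m) (avoids-false⁺ ε ε (⊆⇒≼ []))) (ℤ.*-zeroˡ (coeff (q^ st ε) m)))

F-0-≢ε : ∀ st π → st ε ≡ 0 → π ≢ ε → F st 0 (p312 ∷ π ∷ []) ≈ 1ₚ
F-0-≢ε st π st-ε π≢ε m = trans (F-0 st π m)
  (trans (cong₂ (λ b e → χ b *ᶻ coeff (q^ e) m) (avoids-true⁺ ε π not-≼) st-ε) (ℤ.*-identityˡ (coeff 1ₚ m)))
  where
  not-≼ : ¬ word π ≼ []
  not-≼ e = π≢ε (word-injective (length-0 (word π) (≼-length e)))
    where
    length-0 : ∀ (w : List ℕ) → length w ≤ 0 → w ≡ []
    length-0 [] _ = refl

theorem2p4 : (st : 𝔖 → ℕ) → st ε ≡ 0 →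
    (f : ℕ → ℕ → ℕ) →
    (∀ n k → k ≤ n → (σ₁ σ₂ : 𝔖) →
      σ₁ ∈𝔖 k ⟨ p312 ∷ [] ⟩ → σ₂ ∈𝔖 (n ∸ k) ⟨ p312 ∷ [] ⟩ →
      st 213[ σ₁ ,1, σ₂ ] ≡ f k (n ∸ k) + st σ₁ + st σ₂) →
    (π : 𝔖) → π Avoids p312 →
    (πs : List 𝔖) → IsBlockDecomposition πs π →
    let r = length πs
        Π = p312 ∷ π ∷ []
    in
    (∀ n →
      F st (suc n) Π ≈
      ∑[ k ∈ [ 0 ⋯ n ] ]
        q^ (f k (n ∸ k)) *ₚ
          ((∑[ i ∈ [ 1 ⋯ r ] ]
              F st k (p312 ∷ lower πs i ∷ []) *ₚ F st (n ∸ k) (p312 ∷ upper πs i ∷ []))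
           -ₚ
           (∑[ i ∈ [ 1 ⋯ r ∸ 1 ] ]
              F st k (p312 ∷ lower πs i ∷ []) *ₚ F st (n ∸ k) (p312 ∷ upper πs (i + 1) ∷ []))))
    × (π ≡ ε → F st 0 Π ≈ 0ₚ)
    × (π ≢ ε → F st 0 Π ≈ 1ₚ)
theorem2p4 st st-ε f st-213 π _ πs (_ , π≡) =
  recurrence st f st-213 π πs (trans (cong word π≡) (word-ι⋆ πs)) ,
  F-0-ε st π ,
  F-0-≢ε st π st-ε
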